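{- Let $n$ be a positive integer. There is a graph with order $n$, monophonic position number $2$ and diameter $2$ if and only if $n \in \{3,4,5,8\}$ or $n \geq 11$.
   Context: All graphs are finite, simple and undirected; the order of a graph is its number of vertices. A graph of (finite) diameter is understood to be connected. A monophonic path is an induced (chordless) path. A set $S$ of vertices of a graph $G$ is in monophonic position if no monophonic path of $G$ contains more than two elements of $S$; the monophonic position number of $G$ is the largest size of such a set. -}

module Defs where

open import Data.Fin.Base using (Fin; toℕ)
open import Data.Fin.Subset using (Subset; ⁅_⁆; ⋃; _∩_; ∣_∣)
open import Data.List.Base using (map)
open import Data.Nat.Base using (ℕ; suc; _≤_; _<_)
open import Data.Product.Base using (_×_; ∃-syntax)
open import Data.Sum.Base using (_⊎_)
open import Data.Vec.Base using (Vec; lookup; toList)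
open import Function.Definitions using (Injective)
open import Level using (0ℓ)
open import Relation.Binary.Core using (Rel)
open import Relation.Binary.Definitions using (Decidable; Irreflexive; Symmetric)
open import Relation.Binary.PropositionalEquality.Core using (_≡_)
open import Relation.Nullary.Negation.Core using (¬_)

-- Adjacency is required to be decidable, as it is classically for a
-- finite graph.
record Graph (n : ℕ) : Set₁ where
  field
    Adj    : Rel (Fin n) 0ℓ
    adj?   : Decidable Adj
    sym    : Symmetric Adj
    irrefl : Irreflexive _≡_ Adj

vertexSet : ∀ {n k} → Vec (Fin n) k → Subset n
vertexSet p = ⋃ (map ⁅_⁆ (toList p))

module _ {n : ℕ} (G : Graph n) where

  open Graph G

  data Walk : ℕ → Fin n → Fin n → Set where
    []  : ∀ {u} → Walk 0 u u
    _∷_ : ∀ {k u v w} → Adj u v → Walk k v w → Walk (suc k) u w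

  IsDistance : Fin n → Fin n → ℕ → Set
  IsDistance u v d = Walk d u v × (∀ k → k < d → ¬ Walk k u v)

  -- The first component demands that every pair of vertices has a (finite)
  -- distance, so a graph with a diameter is connected.
  HasDiameter : ℕ → Set
  HasDiameter d =
    (∀ u v → ∃[ e ] (IsDistance u v e × e ≤ d)) ×
    (∃[ u ] ∃[ v ] IsDistance u v d)

  -- A path of length k is the sequence of its k + 1 vertices.
  record IsPath {k : ℕ} (p : Vec (Fin n) (suc k)) : Set where
    field
      distinct    : Injective _≡_ _≡_ (lookup p)
      consecutive : ∀ i j → toℕ j ≡ suc (toℕ i) → Adj (lookup p i) (lookup p j)

  Chordless : ∀ {k} → Vec (Fin n) (suc k) → Set
  Chordless p = ∀ i j → Adj (lookup p i) (lookup p j) →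
                toℕ j ≡ suc (toℕ i) ⊎ toℕ i ≡ suc (toℕ j)

  IsMonophonicPath : ∀ {k} → Vec (Fin n) (suc k) → Set
  IsMonophonicPath p = IsPath p × Chordless p

  InMonophonicPosition : Subset n → Set
  InMonophonicPosition S =
    ∀ {k} (p : Vec (Fin n) (suc k)) → IsMonophonicPath p → ∣ S ∩ vertexSet p ∣ ≤ 2

  HasMonophonicPositionNumber : ℕ → Set
  HasMonophonicPositionNumber m =
    (∃[ S ] (InMonophonicPosition S × ∣ S ∣ ≡ m)) ×
    (∀ S → InMonophonicPosition S → ∣ S ∣ ≤ m)

{-# OPTIONS --safe #-}
module Submission where

open import Data.Bool.Base using (Bool; true; false; if_then_else_; not; _∧_; _∨_; T)
open import Data.Bool.ListAction using (any; all)
open import Data.Bool.Properties using (T?; T-∧; T-∨; T-≡; ∨-comm)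
open import Data.Empty using (⊥; ⊥-elim)
open import Data.Fin.Base as Fin using (Fin; zero; suc; toℕ; inject≤; punchIn; punchOut)
open import Data.Fin.Properties as Fin using (punchIn-punchOut; +↔⊎; *↔×)
open import Data.Fin.Subset as Subset using (Subset; inside; outside; ⁅_⁆; ⋃; _∩_; ∣_∣)
open import Data.Fin.Subset.Properties as Subset using
  (∣p∣≤n; ∣⊥∣≡0; ∣p∩q∣≤∣p∣; x∈p⇒∣p-x∣<∣p∣; x∈p∧x≢y⇒x∈p-y; x∈p∪q⁻; x∈p∪q⁺; x∈p∩q⁻; x∈p∩q⁺;
   x∈⁅y⁆⇒x≡y; x∈⁅x⁆; ∈⊤; ∉⊥)
open import Data.List.Base as List using (List; []; _∷_; length; map; null; filterᵇ; allFin)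
open import Data.List.Membership.Propositional using (_∈_; find)
open import Data.List.Membership.Propositional.Properties using
  (∈-map⁺; ∈-filter⁺; ∈-filter⁻; ∈-allFin; ∈-lookup)
open import Data.List.Properties using (length-map)
open import Data.List.Relation.Unary.All as All using (All; []; _∷_)
import Data.List.Relation.Unary.All.Properties as All
open import Data.List.Relation.Unary.AllPairs using ([]; _∷_)
open import Data.List.Relation.Unary.Any as Any using (here; there)
import Data.List.Relation.Unary.Any.Properties as Any
open import Data.List.Relation.Unary.Unique.Propositional using (Unique)
import Data.List.Relation.Unary.Unique.Propositional.Properties as Unique
open import Data.Maybe.Base using (Maybe; just; nothing; _>>=_)
open import Data.Nat.Base using
  (ℕ; zero; suc; NonZero; _+_; _*_; _≤_; _<_; _≥_; _≤ᵇ_; _<ᵇ_; _≡ᵇ_; z≤n; s≤s)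
open import Data.Nat.Properties as ℕ using (≤-trans; ≤-reflexive; ≮⇒≥)
open import Data.Product.Base as Product using (_×_; _,_; proj₁; proj₂; ∃-syntax; Σ-syntax)
open import Data.Product.Properties using (,-injective)
open import Data.Sum.Base as Sum using (_⊎_; inj₁; inj₂; [_,_]′)
open import Data.Sum.Function.Propositional using (_⊎-↔_)
open import Data.Sum.Properties using (inj₂-injective)
open import Data.Vec.Base as Vec using (Vec; []; _∷_; lookup; toList; fromList; _[_]≔_; replicate)
open import Data.Vec.Functional using () renaming (_∷_ to _◂_)
open import Data.Vec.Properties using (toList∘fromList; lookup∘update; lookup∘update′; lookup-replicate)
open import Function.Base using (_∘_; id; const)
open import Function.Bundles using (Equivalence; Inverse; _⇔_; _↔_; mk⇔)
open import Function.Construct.Composition using (_↔-∘_)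
open import Function.Construct.Identity using (↔-id)
open import Function.Definitions using (Injective)
open import Level using (0ℓ)
open import Relation.Binary.Core using (Rel)
open import Relation.Binary.Definitions using (Irreflexive; Symmetric)
open import Relation.Binary.PropositionalEquality.Core using
  (_≡_; _≢_; refl; sym; trans; cong; cong₂; subst; subst₂; ≢-sym)
open import Relation.Nullary using (¬_; yes; no; does; contradiction)
open import Relation.Nullary.Decidable using (decidable-stable; ¬?; _×-dec_)
open import Defs

-- The monophonic position number is 2 exactly when every three vertices lie on
-- a common induced path.  Such a graph is triangle-free, and two vertices with
-- the same neighbours leave no room for a third vertex on an induced path
-- through both, unless that vertex is adjacent to them.  Together with diameter
-- 2 these conditions are so restrictive that for orders 6, 7, 9 and 10 a case
-- analysis, which names vertices one after another, leaves at most a few graphs,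
-- each with a triple on no induced path.
--
-- In the other direction, three vertices of a suitable base graph are blown up
-- to levels 1, …, k, with adjacency between levels i < j running cyclically
-- between the three types.  Deleting a level of the blow-up gives the blow-up
-- with k - 1 levels, and three vertices use at most three levels, so it is
-- enough to look at k = 3.  Base graphs with 5, 9 and 10 vertices cover all
-- residues modulo 3; the first one yields the Andrásfai graphs.

-- Each fact used to exclude an order either produces a vertex with prescribed adjacencies or
-- forbids an adjacency. Diameter 2 gives common neighbours; the twin condition gives a neighbour of
-- u outside N(v), since in these graphs N(u) ⊆ N(v) already forces equality; triangle-freeness
-- forbids edges. Coverage of a triple is tested directly only when the whole graph is known. Hence
-- a case analysis can be stored as data and run by a Boolean checker whose soundness is proved
-- once. Bounding degrees first keeps the analyses small: with diameter 2, degree at most 3 leaves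
-- at most 1 + 3 + 6 = 10 vertices, and at order 10 only the Petersen graph; degree at most 2 leaves
-- at most 1 + 2 + 2 = 5. The examples are certified as well, by lists of induced paths such that
-- any three vertices lie on one of them. The base graphs with 9 and 10 vertices are not examples
-- themselves, their orders being excluded; their families start at two levels, with orders 12 and
-- 13.

private variable
  f k m n : ℕ

-- Elements of finite subsets

unique⇒length≤ : (xs : List (Fin n)) {S : Subset n} → Unique xs → All (Subset._∈ S) xs → length xs ≤ ∣ S ∣
unique⇒length≤ []       _          _          = z≤n
unique⇒length≤ (x ∷ xs) (x∉ ∷ uxs) (x∈ ∷ xs∈) =
  ≤-trans (s≤s (unique⇒length≤ xs uxs
            (All.zipWith (λ (x≢y , y∈) → x∈p∧x≢y⇒x∈p-y y∈ (≢-sym x≢y)) (x∉ , xs∈))))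
          (x∈p⇒∣p-x∣<∣p∣ x∈)

elements : Subset n → List (Fin n)
elements []            = []
elements (outside ∷ S) = map suc (elements S)
elements (inside  ∷ S) = zero ∷ map suc (elements S)

length-elements : (S : Subset n) → length (elements S) ≡ ∣ S ∣
length-elements []            = refl
length-elements (outside ∷ S) = trans (length-map suc (elements S)) (length-elements S)
length-elements (inside  ∷ S) = cong suc (trans (length-map suc (elements S)) (length-elements S))

elements-∈ : (S : Subset n) → All (Subset._∈ S) (elements S)
elements-∈ []            = []
elements-∈ (outside ∷ S) = All.map⁺ (All.map Vec.there (elements-∈ S))
elements-∈ (inside  ∷ S) = Vec.here ∷ All.map⁺ (All.map Vec.there (elements-∈ S))

elements-unique : (S : Subset n) → Unique (elements S)
elements-unique []            = []
elements-unique (outside ∷ S) = Unique.map⁺ (λ { refl → refl }) (elements-unique S)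
elements-unique (inside  ∷ S) = All.map⁺ (All.universal (λ _ ()) (elements S)) ∷
                                Unique.map⁺ (λ { refl → refl }) (elements-unique S)

threeElements : (S : Subset n) → 3 ≤ ∣ S ∣ →
  ∃[ x ] ∃[ y ] ∃[ z ] (x ≢ y × x ≢ z × y ≢ z) × (x Subset.∈ S × y Subset.∈ S × z Subset.∈ S)
threeElements S 3≤∣S∣ rewrite sym (length-elements S)
  with elements S | elements-∈ S | elements-unique S
... | x ∷ y ∷ z ∷ _ | x∈ ∷ y∈ ∷ z∈ ∷ _ | (x≢y ∷ x≢z ∷ _) ∷ (y≢z ∷ _) ∷ _ =
  x , y , z , (x≢y , x≢z , y≢z) , (x∈ , y∈ , z∈)
... | []         | _ | _ = contradiction 3≤∣S∣ λ ()
... | _ ∷ []     | _ | _ = contradiction 3≤∣S∣ λ { (s≤s ()) }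
... | _ ∷ _ ∷ [] | _ | _ = contradiction 3≤∣S∣ λ { (s≤s (s≤s ())) }

three≰two : {A : Set} {x y z b c : A} → x ≢ y × x ≢ z × y ≢ z →
            x ≡ b ⊎ x ≡ c → y ≡ b ⊎ y ≡ c → z ≡ b ⊎ z ≡ c → ⊥
three≰two (x≢y , _ , _) (inj₁ refl) (inj₁ refl) _           = x≢y refl
three≰two (_ , x≢z , _) (inj₁ refl) _           (inj₁ refl) = x≢z refl
three≰two (_ , _ , y≢z) (inj₁ refl) (inj₂ refl) (inj₂ refl) = y≢z refl
three≰two (x≢y , _ , _) (inj₂ refl) (inj₂ refl) _           = x≢y refl
three≰two (_ , x≢z , _) (inj₂ refl) _           (inj₂ refl) = x≢z refl
three≰two (_ , _ , y≢z) (inj₂ refl) (inj₁ refl) (inj₁ refl) = y≢z refl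

∈-⋃⁻ : {x : Fin n} (xs : List (Fin n)) → x Subset.∈ ⋃ (map ⁅_⁆ xs) → x ∈ xs
∈-⋃⁻ []       x∈ = contradiction x∈ ∉⊥
∈-⋃⁻ (y ∷ xs) x∈ with x∈p∪q⁻ ⁅ y ⁆ _ x∈
... | inj₁ x∈y  = here (x∈⁅y⁆⇒x≡y y x∈y)
... | inj₂ x∈xs = there (∈-⋃⁻ xs x∈xs)

∈-⋃⁺ : {x : Fin n} {xs : List (Fin n)} → x ∈ xs → x Subset.∈ ⋃ (map ⁅_⁆ xs)
∈-⋃⁺ (here refl)  = x∈p∪q⁺ (inj₁ (x∈⁅x⁆ _))
∈-⋃⁺ (there x∈xs) = x∈p∪q⁺ (inj₂ (∈-⋃⁺ x∈xs))

-- Induced paths, triangles and twins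

module InducedPaths {V : Set} (_~_ : Rel V 0ℓ) where

  -- Peeling off the first vertex replaces conditions on pairs of indices by structural recursion.
  -- That a vertex differs from its successor is left to irreflexivity of the adjacency.
  data Induced : List V → Set where
    [-] : ∀ {x} → Induced (x ∷ [])
    _∷_ : ∀ {x y p} → x ~ y × All (λ z → x ≢ z × ¬ x ~ z) p → Induced (y ∷ p) → Induced (x ∷ y ∷ p)

  -- The three vertices may coincide, so a statement about all triples needs no distinctness side
  -- conditions.
  Covered : V → V → V → Set
  Covered x y z = ∃[ p ] (Induced p × x ∈ p × y ∈ p × z ∈ p)

module _ {V W : Set} {_~_ : Rel V 0ℓ} {_≈_ : Rel W 0ℓ} (f : V → W)
         (injective : Injective _≡_ _≡_ f)
         (preserves : ∀ {x y} → x ~ y → f x ≈ f y) (reflects : ∀ {x y} → f x ≈ f y → x ~ y) where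

  open InducedPaths

  Induced-map⁺ : ∀ {p} → Induced _~_ p → Induced _≈_ (map f p)
  Induced-map⁺ [-]                = [-]
  Induced-map⁺ ((x~y , rest) ∷ p) =
    (preserves x~y , All.map⁺ (All.map (λ (x≢z , x≁z) → x≢z ∘ injective , x≁z ∘ reflects) rest)) ∷
    Induced-map⁺ p

  Covered-map⁺ : ∀ {x y z} → Covered _~_ x y z → Covered _≈_ (f x) (f y) (f z)
  Covered-map⁺ (p , ip , x∈ , y∈ , z∈) =
    map f p , Induced-map⁺ ip , ∈-map⁺ f x∈ , ∈-map⁺ f y∈ , ∈-map⁺ f z∈

module InducedPathProperties {V : Set} {_~_ : Rel V 0ℓ}
  (irrefl : Irreflexive _≡_ _~_) (symm : Symmetric _~_) where

  open InducedPaths _~_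

  private
    next : ∀ {x y p z} → Induced (x ∷ y ∷ p) → z ∈ y ∷ p → x ~ z → z ≡ y
    next _                 (here z≡y)  _   = z≡y
    next ((_ , rest) ∷ _) (there z∈p) x~z = contradiction x~z (proj₂ (All.lookup rest z∈p))

    -- Two neighbours of the first vertex both have to be the second vertex.
    head≁both : ∀ {x p y z} → Induced (x ∷ p) → y ∈ x ∷ p → z ∈ x ∷ p → x ~ y → x ~ z → y ~ z → ⊥
    head≁both _   (here refl) _          x~y _   _   = irrefl refl x~y
    head≁both _   (there _) (here refl)  _   x~z _   = irrefl refl x~z
    head≁both ip@(_ ∷ _) (there y∈) (there z∈) x~y x~z y~z =
      irrefl (trans (next ip y∈ x~y) (sym (next ip z∈ x~z))) y~z

  -- Strip the path down to the first of the three vertices on it: both others are its neighbours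
  -- further along, hence both equal the next vertex, although they are adjacent to each other.
  triangle-uncovered : ∀ {x y z} → x ~ y → y ~ z → z ~ x → ¬ Covered x y z
  triangle-uncovered x~y y~z z~x (p , ip , x∈ , y∈ , z∈) = go ip x∈ y∈ z∈
    where
    go : ∀ {p} → Induced p → _ ∈ p → _ ∈ p → _ ∈ p → ⊥
    go ip (here refl) y∈ z∈ = head≁both ip y∈ z∈ x~y (symm z~x) y~z
    go ip (there x∈) (here refl) z∈ = head≁both ip z∈ (there x∈) y~z (symm x~y) z~x
    go ip (there x∈) (there y∈) (here refl) = head≁both ip (there x∈) (there y∈) z~x (symm y~z) x~y
    go (_ ∷ ip) (there x∈) (there y∈) (there z∈) = go ip x∈ y∈ z∈

  -- An induced path through the twins a and b has the form a x b or b x a.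
  twins-uncovered : ∀ {a b c} → a ≢ b → ¬ a ~ b → (∀ {x} → a ~ x → b ~ x) → (∀ {x} → b ~ x → a ~ x) →
                    c ≢ a → c ≢ b → ¬ a ~ c → ¬ Covered a b c
  twins-uncovered {a} {b} a≢b a≁b ab ba c≢a c≢b a≁c (p , ip , a∈ , b∈ , c∈)
    with shape ip a∈ b∈
    where
    ends : ∀ {a b} → a ≢ b → ¬ a ~ b → (∀ {x} → a ~ x → b ~ x) → (∀ {x} → b ~ x → a ~ x) →
           ∀ {p} → Induced (a ∷ p) → b ∈ p → ∃[ x ] (a ~ x × p ≡ x ∷ b ∷ [])
    ends a≢b a≁b ab ba ((a~b , _) ∷ _) (here refl) = contradiction a~b a≁b
    -- The successor x of a is also adjacent to b, so b comes right after x. A vertex following b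
    -- would be adjacent to b, hence to its twin a: a chord.
    ends a≢b a≁b ab ba ((a~x , rest) ∷ ip@(_ ∷ ip′)) (there b∈)
      with refl ← next ip b∈ (symm (ab a~x)) with ip′
    ... | [-] = _ , a~x , refl
    ... | (b~w , _) ∷ _ = contradiction (ba b~w) (proj₂ (All.lookup rest (there (here refl))))

    shape : ∀ {p} → Induced p → a ∈ p → b ∈ p → ∃[ x ] (a ~ x × (p ≡ a ∷ x ∷ b ∷ [] ⊎ p ≡ b ∷ x ∷ a ∷ []))
    shape ip (here refl) (here refl) = contradiction refl a≢b
    shape ip (here refl) (there b∈) with x , a~x , refl ← ends a≢b a≁b ab ba ip b∈ = x , a~x , inj₁ refl
    shape ip (there a∈) (here refl)
      with x , b~x , refl ← ends (a≢b ∘ sym) (a≁b ∘ symm) ba ab ip a∈ = x , ba b~x , inj₂ refl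
    -- A vertex preceding one twin is adjacent to the other one as well, which is further along the
    -- path: again a chord.
    shape ((w~ , rest) ∷ ip) (there a∈) (there b∈) with shape ip a∈ b∈
    ... | x , a~x , inj₁ refl =
      contradiction (symm (ab (symm w~))) (proj₂ (All.lookup rest (there (here refl))))
    ... | x , a~x , inj₂ refl =
      contradiction (symm (ba (symm w~))) (proj₂ (All.lookup rest (there (here refl))))
  ... | x , a~x , inj₁ refl = excluded c∈
    where
    excluded : _ ∈ a ∷ x ∷ b ∷ [] → ⊥
    excluded (here c≡a)                 = c≢a c≡a
    excluded (there (here refl))        = a≁c a~x
    excluded (there (there (here c≡b))) = c≢b c≡b
  ... | x , a~x , inj₂ refl = excluded c∈
    where
    excluded : _ ∈ b ∷ x ∷ a ∷ [] → ⊥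
    excluded (here c≡b)                 = c≢b c≡b
    excluded (there (here refl))        = a≁c a~x
    excluded (there (there (here c≡a))) = c≢a c≡a

-- Monophonic position number 2 in terms of covered triples

module MonophonicPosition {n : ℕ} (G : Graph n) where

  open import Data.List.Membership.DecPropositional (Fin._≟_ {n}) using (_∈?_)
  open Graph G using (Adj; adj?; irrefl) renaming (sym to Adj-sym)
  open InducedPaths Adj

  monophonic⇒induced : ∀ {k} (p : Vec (Fin n) (suc k)) → IsMonophonicPath G p → Induced (toList p)
  monophonic⇒induced (x ∷ [])    _ = [-]
  monophonic⇒induced (x ∷ y ∷ p) (isPath , chordless) =
    (IsPath.consecutive isPath zero (suc zero) refl , away p away′) ∷
    monophonic⇒induced (y ∷ p) (record
      { distinct    = λ eq → Fin-suc-injective (IsPath.distinct isPath eq)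
      ; consecutive = λ i j eq → IsPath.consecutive isPath (suc i) (suc j) (cong suc eq)
      } , λ i j adj → Sum.map ℕ.suc-injective ℕ.suc-injective (chordless (suc i) (suc j) adj))
    where
    Fin-suc-injective : ∀ {m} {i j : Fin m} → suc i ≡ suc j → i ≡ j
    Fin-suc-injective refl = refl

    away′ : ∀ i → x ≢ lookup p i × ¬ Adj x (lookup p i)
    away′ i = (λ eq → contradiction (IsPath.distinct isPath {zero} {suc (suc i)} eq) λ ()) ,
              (λ adj → [ (λ ()) , (λ ()) ]′ (chordless zero (suc (suc i)) adj))

    away : ∀ {m} (q : Vec (Fin n) m) → (∀ i → x ≢ lookup q i × ¬ Adj x (lookup q i)) →
           All (λ z → x ≢ z × ¬ Adj x z) (toList q)
    away []      _ = []
    away (z ∷ q) h = h zero ∷ away q (h ∘ suc)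

  induced⇒monophonic : ∀ {k} (p : Vec (Fin n) (suc k)) → Induced (toList p) → IsMonophonicPath G p
  induced⇒monophonic (x ∷ []) _ = record
    { distinct    = λ { {zero} {zero} _ → refl }
    ; consecutive = λ { zero zero () }
    } , λ { zero zero adj → contradiction adj (irrefl refl) }
  induced⇒monophonic (x ∷ y ∷ p) ((x~y , rest) ∷ ip) = record
    { distinct = distinct _ _ ; consecutive = consecutive } , chordless
    where
    tail = induced⇒monophonic (y ∷ p) ip

    away : ∀ i → x ≢ lookup p i × ¬ Adj x (lookup p i)
    away = go p rest
      where
      go : ∀ {m} (q : Vec (Fin n) m) → All (λ z → x ≢ z × ¬ Adj x z) (toList q) →
           ∀ i → x ≢ lookup q i × ¬ Adj x (lookup q i)
      go (_ ∷ _) (h ∷ _)  zero    = h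
      go (_ ∷ q) (_ ∷ hs) (suc i) = go q hs i

    x≢ : ∀ i → x ≢ lookup (y ∷ p) i
    x≢ zero    refl = irrefl refl x~y
    x≢ (suc i) = proj₁ (away i)

    distinct : ∀ i j → lookup (x ∷ y ∷ p) i ≡ lookup (x ∷ y ∷ p) j → i ≡ j
    distinct zero    zero    _  = refl
    distinct zero    (suc j) eq = contradiction eq (x≢ j)
    distinct (suc i) zero    eq = contradiction (sym eq) (x≢ i)
    distinct (suc i) (suc j) eq = cong suc (IsPath.distinct (proj₁ tail) eq)

    consecutive : ∀ i j → toℕ j ≡ suc (toℕ i) → Adj (lookup (x ∷ y ∷ p) i) (lookup (x ∷ y ∷ p) j)
    consecutive zero    (suc zero) _  = x~y
    consecutive (suc i) (suc j)    eq = IsPath.consecutive (proj₁ tail) i j (ℕ.suc-injective eq)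

    chordless : ∀ i j → Adj (lookup (x ∷ y ∷ p) i) (lookup (x ∷ y ∷ p) j) →
                toℕ j ≡ suc (toℕ i) ⊎ toℕ i ≡ suc (toℕ j)
    chordless zero          zero          adj = contradiction adj (irrefl refl)
    chordless zero          (suc zero)    _   = inj₁ refl
    chordless zero          (suc (suc j)) adj = contradiction adj (proj₂ (away j))
    chordless (suc zero)    zero          _   = inj₂ refl
    chordless (suc (suc i)) zero          adj = contradiction (Adj-sym adj) (proj₂ (away i))
    chordless (suc i)       (suc j)       adj = Sum.map (cong suc) (cong suc) (proj₂ tail i j adj)

  covered⇒number≡2 : 2 ≤ n → (∀ x y z → Covered x y z) → HasMonophonicPositionNumber G 2
  covered⇒number≡2 (s≤s (s≤s (z≤n {m}))) covered =
    (pair , (λ p _ → ≤-trans (∣p∩q∣≤∣p∣ pair (vertexSet p)) (≤-reflexive ∣pair∣≡2)) , ∣pair∣≡2) ,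
    λ S inPosition → ≮⇒≥ (3≰ S inPosition)
    where
    -- Vertices 0 and 1: a set with two elements meets every path in at most two of them.
    pair = inside ∷ inside ∷ Subset.⊥

    ∣pair∣≡2 : ∣ pair ∣ ≡ 2
    ∣pair∣≡2 = cong (2 +_) (∣⊥∣≡0 m)

    3≰ : ∀ S → InMonophonicPosition G S → ¬ 3 ≤ ∣ S ∣
    3≰ S inPosition 3≤∣S∣
      with x , y , z , (x≢y , x≢z , y≢z) , (x∈S , y∈S , z∈S) ← threeElements S 3≤∣S∣
      with v ∷ vs , ip , x∈p , y∈p , z∈p ← covered x y z
      = ℕ.n≮n 2 (≤-trans
          (unique⇒length≤ (x ∷ y ∷ z ∷ []) ((x≢y ∷ x≢z ∷ []) ∷ (y≢z ∷ []) ∷ [] ∷ [])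
            (∈∩ x∈S x∈p ∷ ∈∩ y∈S y∈p ∷ ∈∩ z∈S z∈p ∷ []))
          (inPosition p (induced⇒monophonic p (subst Induced (sym p≡) ip))))
      where
      p  = v ∷ fromList vs
      p≡ : toList p ≡ v ∷ vs
      p≡ = cong (v ∷_) (toList∘fromList vs)

      ∈∩ : ∀ {u} → u Subset.∈ S → u ∈ v ∷ vs → u Subset.∈ S ∩ vertexSet p
      ∈∩ {u} u∈S u∈p = x∈p∩q⁺ (u∈S , ∈-⋃⁺ (subst (u ∈_) (sym p≡) u∈p))

  -- If no induced path contained a, b and c, they would form a set of size 3 in monophonic
  -- position. Maximality yields no explicit path, hence the double negation; it is enough, because
  -- coverage is only ever used to derive a contradiction.
  number≡2⇒¬¬covered : HasMonophonicPositionNumber G 2 →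
    ∀ {a b c} → a ≢ b → a ≢ c → b ≢ c → ¬ ¬ Covered a b c
  number≡2⇒¬¬covered (_ , maximal) {a} {b} {c} a≢b a≢c b≢c uncovered =
    ℕ.n≮n 2 (≤-trans
      (unique⇒length≤ abc ((a≢b ∷ a≢c ∷ []) ∷ (b≢c ∷ []) ∷ [] ∷ []) (All.tabulate ∈-⋃⁺))
      (maximal S inPosition))
    where
    abc = a ∷ b ∷ c ∷ []
    S   = ⋃ (map ⁅_⁆ abc)

    rotate-∈ : ∀ {x a b c : Fin n} → x ∈ a ∷ b ∷ c ∷ [] → x ∈ b ∷ c ∷ a ∷ []
    rotate-∈ (here x≡a)                 = there (there (here x≡a))
    rotate-∈ (there (here x≡b))         = here x≡b
    rotate-∈ (there (there (here x≡c))) = there (here x≡c)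

    module _ {x y z : Fin n} (distinct : x ≢ y × x ≢ z × y ≢ z) {q : List (Fin n)}
             (x∈q : x ∈ q) (y∈q : y ∈ q) (z∈q : z ∈ q) where

      -- A path missing a would leave only b and c as values for the three distinct vertices x, y
      -- and z.
      hit : ∀ {a b c} → x ∈ a ∷ b ∷ c ∷ [] → y ∈ a ∷ b ∷ c ∷ [] → z ∈ a ∷ b ∷ c ∷ [] → a ∈ q
      hit {a} x∈ y∈ z∈ with a ∈? q
      ... | yes a∈q = a∈q
      ... | no  a∉q = ⊥-elim (three≰two distinct (other x∈q x∈) (other y∈q y∈) (other z∈q z∈))
        where
        other : ∀ {u b c} → u ∈ q → u ∈ a ∷ b ∷ c ∷ [] → u ≡ b ⊎ u ≡ c
        other u∈q (here refl)                = contradiction u∈q a∉q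
        other u∈q (there (here u≡b))         = inj₁ u≡b
        other u∈q (there (there (here u≡c))) = inj₂ u≡c

      hits : x ∈ abc → y ∈ abc → z ∈ abc → a ∈ q × b ∈ q × c ∈ q
      hits x∈ y∈ z∈ = hit x∈ y∈ z∈ , hit (rotate-∈ x∈) (rotate-∈ y∈) (rotate-∈ z∈) ,
                      hit (rotate-∈ (rotate-∈ x∈)) (rotate-∈ (rotate-∈ y∈)) (rotate-∈ (rotate-∈ z∈))

    inPosition : InMonophonicPosition G S
    inPosition p mono = ≮⇒≥ λ 3≤ →
      let x , y , z , distinct , x∈ , y∈ , z∈ = threeElements (S ∩ vertexSet p) 3≤
      in uncovered (toList p , monophonic⇒induced p mono ,
           hits distinct (∈p x∈) (∈p y∈) (∈p z∈) (∈S x∈) (∈S y∈) (∈S z∈))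
      where
      ∈S : ∀ {u} → u Subset.∈ S ∩ vertexSet p → u ∈ abc
      ∈S u∈ = ∈-⋃⁻ abc (proj₁ (x∈p∩q⁻ S (vertexSet p) u∈))

      ∈p : ∀ {u} → u Subset.∈ S ∩ vertexSet p → u ∈ toList p
      ∈p u∈ = ∈-⋃⁻ (toList p) (proj₂ (x∈p∩q⁻ S (vertexSet p) u∈))

-- Boolean search for an induced path through given vertices

_==_ : Fin m → Fin m → Bool
i == j = does (i Fin.≟ j)

==⇒≡ : (i j : Fin m) → T (i == j) → i ≡ j
==⇒≡ i j t with i Fin.≟ j
... | yes i≡j = i≡j

≡⇒== : (i j : Fin m) → i ≡ j → T (i == j)
≡⇒== i j i≡j with i Fin.≟ j
... | yes _   = _
... | no  i≢j = contradiction i≡j i≢j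

T-not⁻ : ∀ {b} → T (not b) → ¬ T b
T-not⁻ {false} _ ()

T-not⁺ : ∀ {b} → ¬ T b → T (not b)
T-not⁺ {false} _  = _
T-not⁺ {true}  ¬t = contradiction _ ¬t

_∈ᵇ_ : Fin m → List (Fin m) → Bool
i ∈ᵇ xs = any (i ==_) xs

∈⇒∈ᵇ : {i : Fin m} {xs : List (Fin m)} → i ∈ xs → T (i ∈ᵇ xs)
∈⇒∈ᵇ = Any.any⁺ _ ∘ Any.map (≡⇒== _ _)

∈ᵇ⇒∈ : {i : Fin m} (xs : List (Fin m)) → T (i ∈ᵇ xs) → i ∈ xs
∈ᵇ⇒∈ xs = Any.map (==⇒≡ _ _) ∘ Any.any⁻ _ xs

module PathSearch {m : ℕ} (_~ᵇ_ : Fin m → Fin m → Bool) where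

  open InducedPaths (λ i j → T (i ~ᵇ j))

  -- No induced path starting at i whose other vertices are available
  -- contains all targets.
  uncoveredFrom : ℕ → Fin m → List (Fin m) → List (Fin m) → Bool
  -- Out of fuel, nothing is claimed. An induced path has at most `m` vertices, so `uncovered`
  -- starts with fuel `m`.
  uncoveredFrom zero    _ _         _       = false
  uncoveredFrom (suc f) i available targets =
    let left = filterᵇ (not ∘ (i ==_)) targets in
    not (null left) ∧
    (any (λ t → not (t ∈ᵇ available)) left ∨
     -- Dropping the neighbours of `i` keeps the continuation chordless; it also drops `j`, so no
     -- vertex is visited twice.
     all (λ j → not (i ~ᵇ j) ∨ uncoveredFrom f j (filterᵇ (not ∘ (i ~ᵇ_)) available) left) available)

  uncoveredFrom-sound : ∀ f {i p} available targets → T (uncoveredFrom f i available targets) →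
    Induced (i ∷ p) → All (_∈ available) p → ¬ All (_∈ i ∷ p) targets
  uncoveredFrom-sound (suc f) {i} {p} available targets check ip p⊆ targets∈
    = go ip p⊆ left∈ (Equivalence.to T-∧ check)
    where
    left = filterᵇ (not ∘ (i ==_)) targets

    left∈ : All (_∈ p) left
    left∈ = All.tabulate λ {t} t∈left →
      let t∈targets , i≠t = ∈-filter⁻ (T? ∘ not ∘ (i ==_)) t∈left in
      case-∈ (T-not⁻ i≠t) (All.lookup targets∈ t∈targets)
      where
      case-∈ : ∀ {t} → ¬ T (i == t) → t ∈ i ∷ p → t ∈ p
      case-∈ i≠t (here refl) = contradiction (≡⇒== i i refl) i≠t
      case-∈ i≠t (there t∈p) = t∈p

    go : ∀ {p} → Induced (i ∷ p) → All (_∈ available) p → All (_∈ p) left →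
         T (not (null left)) × _ → ⊥
    go ip p⊆ left∈ (nonempty , rest) with Equivalence.to T-∨ rest
    ... | inj₁ unavailable with t , t∈left , t∉ ← find (Any.any⁻ _ left unavailable) =
      T-not⁻ t∉ (∈⇒∈ᵇ (All.lookup p⊆ (All.lookup left∈ t∈left)))
    go [-] p⊆ left∈ (nonempty , rest) | inj₂ steps with left | left∈
    ... | []    | _      = nonempty
    ... | _ ∷ _ | () ∷ _
    go ((i~j , away) ∷ ip) (j∈ ∷ q⊆) left∈ (nonempty , rest) | inj₂ steps
      with Equivalence.to T-∨ (All.lookup (All.all⁺ _ available steps) j∈)
    ... | inj₁ i≁j  = T-not⁻ i≁j i~j
    ... | inj₂ step = uncoveredFrom-sound f _ left step ip
      (All.zipWith (λ (z∈ , _ , i≁z) → ∈-filter⁺ (T? ∘ not ∘ (i ~ᵇ_)) z∈ (T-not⁺ i≁z)) (q⊆ , away)) left∈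

  uncovered : Fin m → Fin m → Fin m → Bool
  uncovered a b c =
    all (λ i → uncoveredFrom m i (filterᵇ (not ∘ (i ==_)) (allFin m)) (a ∷ b ∷ c ∷ [])) (allFin m)

  uncovered-sound : (∀ i → ¬ T (i ~ᵇ i)) → ∀ {a b c} → T (uncovered a b c) → ¬ Covered a b c
  uncovered-sound irrefl check (i ∷ p , ip , a∈ , b∈ , c∈) =
    uncoveredFrom-sound m _ _ (All.lookup (All.all⁺ _ (allFin m) check) (∈-allFin i)) ip
      (All.map (λ i≢j → ∈-filter⁺ (T? ∘ not ∘ (i ==_)) (∈-allFin _) (T-not⁺ (i≢j ∘ ==⇒≡ i _))) (others ip))
      (a∈ ∷ b∈ ∷ c∈ ∷ [])
    where
    others : ∀ {i p} → Induced (i ∷ p) → All (i ≢_) p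
    others [-]                = []
    others ((i~j , away) ∷ _) = (λ { refl → irrefl _ i~j }) ∷ All.map proj₁ away

-- Case analyses and their checker

-- Partial knowledge of the graph induced by m distinct vertices: each new
-- vertex comes with what is known of its adjacency to the earlier ones.

data State : ℕ → Set where
  []  : State 0
  _∷_ : Vec (Maybe Bool) m → State m → State (suc m)

-- Each pair is stored once, in the row of the vertex named later. Reading the table thus makes it
-- symmetric and loopless by construction.
entry : State m → Fin m → Fin m → Maybe Bool
entry (r ∷ s) zero    zero    = just false
entry (r ∷ s) zero    (suc j) = lookup r j
entry (r ∷ s) (suc i) zero    = lookup r i
entry (r ∷ s) (suc i) (suc j) = entry s i j

set : Bool → State m → Fin m → Fin m → State m
-- The diagonal is fixed. An attempt to create a loop never gets here: `link` rejects it, as every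
-- vertex is `apart` from itself.
set b (r ∷ s) zero    zero    = r ∷ s
set b (r ∷ s) zero    (suc j) = (r [ j ]≔ just b) ∷ s
set b (r ∷ s) (suc i) zero    = (r [ i ]≔ just b) ∷ s
set b (r ∷ s) (suc i) (suc j) = r ∷ set b s i j

blank : ∀ m → State m
blank zero    = []
blank (suc m) = replicate m nothing ∷ blank m

-- Vertex 0 is the centre. The entries between leaves stay open, but `apart` finds them nonadjacent
-- through the centre.
star : ∀ d → State (suc d)
star d = replicate d (just true) ∷ blank d

isTrue isFalse : Maybe Bool → Bool
isTrue (just true) = true
isTrue _           = false
isFalse (just false) = true
isFalse _            = false

-- Triangle-freeness enters the checker only here: a known common neighbour separates its two
-- neighbours without any step of a plan.
adjacent apart : State m → Fin m → Fin m → Bool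
adjacent s i j = isTrue (entry s i j)
apart {m} s i j = isFalse (entry s i j) ∨ any (λ k → adjacent s i k ∧ adjacent s k j) (allFin m)

-- The result `nothing` means that the new information contradicts what is known, so that this case
-- is closed.
link : Bool → State m → Fin m → Fin m → Maybe (State m)
link true  s i j = if apart s i j then nothing else just (set true s i j)
link false s i j = if adjacent s i j then nothing else just (set false s i j)

Constraints : ℕ → Set
Constraints m = List (Fin m × Bool)

impose : State m → Fin m → Constraints m → Maybe (State m)
impose s k []            = just s
impose s k ((i , b) ∷ c) = link b s i k >>= λ s′ → impose s′ k c

later : Constraints m → Constraints (suc m)
later = map (λ (i , b) → suc i , b)

-- A case analysis, in which vertices are numbered backwards: 0 is the one named
-- last.  In `common i j` a common neighbour of i and j is named, in
-- `exclusive i j k` a neighbour of i that is not a neighbour of j, where k is a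
-- further vertex not adjacent to i (so that i and j are not twins).  Their
-- subplans treat in turn those named vertices, and finally the new one, for
-- which no contradiction is immediate.  `crowded i` appeals to a star that has
-- been excluded before, and `stuck a b c` claims that the graph is completely
-- known and has no induced path through a, b and c.
data Plan : Set where
  common    : ℕ → ℕ → List Plan → Plan
  exclusive : ℕ → ℕ → ℕ → List Plan → Plan
  fresh     : Plan → Plan
  split     : ℕ → ℕ → Plan → Plan → Plan
  crowded   : ℕ → Plan
  stuck     : ℕ → ℕ → ℕ → Plan
  void      : Plan

-- Numbers beyond m are sent to m.
# : ℕ → Fin (suc m)
# zero            = zero
# {zero}  (suc _) = zero
# {suc m} (suc i) = suc (# i)

-- `n` is the order of the graph, and `d` a degree known to be reached by no vertex.
module Checker (n d : ℕ) where

  known : State m → Bool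
  known {m} s = all (λ i → all (λ j → adjacent s i j ∨ apart s i j) (allFin m)) (allFin m)

  refute  : Plan → State (suc m) → Bool
  -- A vertex whose existence is guaranteed may be one named before. The list holds the candidates
  -- not yet tried, the constraints its required adjacencies; a candidate refuted by `impose`
  -- consumes no subplan.
  witness : List Plan → State (suc m) → List (Fin (suc m)) → Constraints (suc m) → Bool
  old     : List Plan → Maybe (State (suc m)) → State (suc m) → List (Fin (suc m)) → Constraints (suc m) →
            Bool
  new     : List Plan → Maybe (State (suc m)) → Bool
  alternative : Plan → Maybe (State (suc m)) → Bool

  refute {m} (common i j ps) s =
    apart s (# i) (# j) ∧ not (# {m} i == # j) ∧
    witness ps s (allFin _) ((# i , true) ∷ (# j , true) ∷ [])
  refute {m} (exclusive i j k ps) s =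
    (apart s (# i) (# j) ∧ not (# {m} i == # j)) ∧
    (apart s (# k) (# i) ∧ not (# {m} k == # i) ∧ not (# {m} k == # j)) ∧
    witness ps s (allFin _) ((# i , true) ∷ (# j , false) ∷ [])
  refute {m} (fresh p)     s = (suc m <ᵇ n) ∧ refute p (replicate _ nothing ∷ s)
  refute (split i j p q)   s =
    alternative p (link true s (# i) (# j)) ∧ alternative q (link false s (# i) (# j))
  refute (crowded i)       s = d ≤ᵇ length (filterᵇ (adjacent s (# i)) (allFin _))
  refute {m} (stuck a b c) s =
    (n ≤ᵇ suc m) ∧ (not (# {m} a == # b) ∧ not (# {m} a == # c) ∧ not (# {m} b == # c)) ∧
    known s ∧ PathSearch.uncovered (adjacent s) (# a) (# b) (# c)
  refute void              s = false

  witness {m} ps s []       c =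
    -- With `suc m` vertices named, a new one exists only if `suc m` is less than `n`; otherwise the
    -- candidates are exhausted.
    not (suc m <ᵇ n) ∨ new ps (impose (replicate _ nothing ∷ s) zero (later c))
  witness     ps s (k ∷ ks) c = old ps (impose s k c) s ks c

  old ps       nothing   s ks c = witness ps s ks c
  old []       (just _)  s ks c = false
  old (p ∷ ps) (just s′) s ks c = refute p s′ ∧ witness ps s ks c

  new []      nothing  = true
  new []      (just _) = false
  new (p ∷ _) s        = alternative p s

  alternative p nothing  = true
  alternative p (just s) = refute p s

-- Soundness of the checker

lookup-update : ∀ {A : Set} (r : Vec A m) j b l →
  lookup (r [ j ]≔ b) l ≡ lookup r l ⊎ lookup (r [ j ]≔ b) l ≡ b × l ≡ j
lookup-update r j b l with l Fin.≟ j
... | yes refl = inj₂ (lookup∘update j r b , refl)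
... | no  l≢j  = inj₁ (lookup∘update′ l≢j r b)

entry-set : ∀ b (s : State m) i j k l → entry (set b s i j) k l ≡ entry s k l ⊎
            entry (set b s i j) k l ≡ just b × (k ≡ i × l ≡ j ⊎ k ≡ j × l ≡ i)
entry-set b (r ∷ s) zero    zero    _       _       = inj₁ refl
entry-set b (r ∷ s) zero    (suc j) zero    zero    = inj₁ refl
entry-set b (r ∷ s) zero    (suc j) zero    (suc l) =
  Sum.map id (λ { (eq , refl) → eq , inj₁ (refl , refl) }) (lookup-update r j (just b) l)
entry-set b (r ∷ s) zero    (suc j) (suc k) zero    =
  Sum.map id (λ { (eq , refl) → eq , inj₂ (refl , refl) }) (lookup-update r j (just b) k)
entry-set b (r ∷ s) zero    (suc j) (suc k) (suc l) = inj₁ refl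
entry-set b (r ∷ s) (suc i) zero    zero    zero    = inj₁ refl
entry-set b (r ∷ s) (suc i) zero    zero    (suc l) =
  Sum.map id (λ { (eq , refl) → eq , inj₂ (refl , refl) }) (lookup-update r i (just b) l)
entry-set b (r ∷ s) (suc i) zero    (suc k) zero    =
  Sum.map id (λ { (eq , refl) → eq , inj₁ (refl , refl) }) (lookup-update r i (just b) k)
entry-set b (r ∷ s) (suc i) zero    (suc k) (suc l) = inj₁ refl
entry-set b (r ∷ s) (suc i) (suc j) zero    zero    = inj₁ refl
entry-set b (r ∷ s) (suc i) (suc j) zero    (suc l) = inj₁ refl
entry-set b (r ∷ s) (suc i) (suc j) (suc k) zero    = inj₁ refl
entry-set b (r ∷ s) (suc i) (suc j) (suc k) (suc l) with entry-set b s i j k l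
... | inj₁ eq                        = inj₁ eq
... | inj₂ (eq , inj₁ (refl , refl)) = inj₂ (eq , inj₁ (refl , refl))
... | inj₂ (eq , inj₂ (refl , refl)) = inj₂ (eq , inj₂ (refl , refl))

isTrue-just : ∀ {e} → T (isTrue e) → e ≡ just true
isTrue-just {just true} _ = refl

isFalse-just : ∀ {e} → T (isFalse e) → e ≡ just false
isFalse-just {just false} _ = refl

entry-diagonal : ∀ (s : State m) i → entry s i i ≡ just false
entry-diagonal (r ∷ s) zero    = refl
entry-diagonal (r ∷ s) (suc i) = entry-diagonal s i

entry-blank : ∀ m i j {b} → entry (blank m) i j ≡ just b → b ≡ false × i ≡ j
entry-blank (suc m) zero    zero    refl = refl , refl
entry-blank (suc m) zero    (suc j) eq   = contradiction (trans (sym (lookup-replicate j nothing)) eq) λ ()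
entry-blank (suc m) (suc i) zero    eq   = contradiction (trans (sym (lookup-replicate i nothing)) eq) λ ()
entry-blank (suc m) (suc i) (suc j) eq with refl , refl ← entry-blank m i j eq = refl , refl

◂-injective : ∀ {v : Fin n} {x : Fin m → Fin n} → (∀ i → x i ≢ v) →
              Injective _≡_ _≡_ x → Injective _≡_ _≡_ (v ◂ x)
◂-injective miss inj {zero}  {zero}  _  = refl
◂-injective miss inj {zero}  {suc j} eq = contradiction (sym eq) (miss j)
◂-injective miss inj {suc i} {zero}  eq = contradiction eq (miss i)
◂-injective miss inj {suc i} {suc j} eq = cong suc (inj eq)

injective⇒surjective : n ≤ m → (x : Fin m → Fin n) → Injective _≡_ _≡_ x → ∀ v → ∃[ i ] x i ≡ v
injective⇒surjective n≤m x inj v with Fin.any? (λ i → x i Fin.≟ v)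
... | yes hit = hit
... | no miss =
  contradiction (≤-trans (Fin.injective⇒≤ (◂-injective (λ i eq → miss (i , eq)) inj)) n≤m) (ℕ.n≮n _)

-- Preimages of all elements would inject `Fin n` into `Fin m`. This serves twice: to name a fresh
-- vertex, and to find a level of a blow-up that three vertices avoid.
missed : m < n → (x : Fin m → Fin n) → ∃[ v ] (∀ i → x i ≢ v)
missed {m} {n} m<n x = Product.map₂ (λ miss i eq → miss (i , eq))
  (Fin.¬∀⟶∃¬ n (λ v → ∃[ i ] x i ≡ v) (λ v → Fin.any? (λ i → x i Fin.≟ v)) notAll)
  where
  notAll : ¬ (∀ v → ∃[ i ] x i ≡ v)
  notAll hits = ℕ.<⇒≱ m<n (Fin.injective⇒≤ {f = proj₁ ∘ hits}
    λ {u} {v} eq → trans (sym (proj₂ (hits u))) (trans (cong x eq) (proj₂ (hits v))))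

lookup-injective : ∀ {A : Set} {xs : List A} → Unique xs → Injective _≡_ _≡_ (List.lookup xs)
lookup-injective (x∉ ∷ uxs) {zero}  {zero}  _  = refl
lookup-injective (x∉ ∷ uxs) {zero}  {suc j} eq = contradiction eq (All.lookup x∉ (∈-lookup j))
lookup-injective (x∉ ∷ uxs) {suc i} {zero}  eq = contradiction (sym eq) (All.lookup x∉ (∈-lookup i))
lookup-injective (x∉ ∷ uxs) {suc i} {suc j} eq = cong suc (lookup-injective uxs eq)

-- This is all that the case analyses use of a graph. `exclusiveNeighbour` excludes even N(u) ⊆
-- N(v), not just twins; its `w` is the third vertex with which twins could not share an induced
-- path.
record ObstructionFree {n} (G : Graph n) : Set where
  open Graph G
  open InducedPaths Adj
  field
    triangle-free : ∀ {u v w} → Adj u v → Adj v w → ¬ Adj u w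
    commonNeighbour : ∀ {u v} → u ≢ v → ¬ Adj u v → ∃[ w ] (Adj u w × Adj v w)
    exclusiveNeighbour : ∀ {u v w} → u ≢ v → ¬ Adj u v → w ≢ u → w ≢ v → ¬ Adj w u →
      ∃[ x ] (Adj u x × ¬ Adj v x)
    ¬¬covered : ∀ {u v w} → u ≢ v → u ≢ w → v ≢ w → ¬ ¬ Covered u v w

module Soundness {n} (G : Graph n) (free : ObstructionFree G) where

  open Graph G renaming (sym to Adj-sym)
  open ObstructionFree free

  Agrees : Bool → Fin n → Fin n → Set
  Agrees true  u v = Adj u v
  Agrees false u v = ¬ Adj u v

  Agrees-sym : ∀ b {u v} → Agrees b u v → Agrees b v u
  Agrees-sym true  = Adj-sym
  Agrees-sym false = _∘ Adj-sym

  record Realizes (x : Fin m → Fin n) (s : State m) : Set where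
    field
      injective : Injective _≡_ _≡_ x
      agrees    : ∀ i j {b} → entry s i j ≡ just b → Agrees b (x i) (x j)

  Refuted : State m → Set
  Refuted s = ∀ {x} → ¬ Realizes x s

  module _ {x : Fin m → Fin n} {s : State m} (real : Realizes x s) where

    open Realizes real

    adjacent-sound : ∀ i j → T (adjacent s i j) → Adj (x i) (x j)
    adjacent-sound i j adj = agrees i j (isTrue-just adj)

    apart-sound : ∀ i j → T (apart s i j) → ¬ Adj (x i) (x j)
    apart-sound i j ap with Equivalence.to T-∨ ap
    ... | inj₁ f = agrees i j (isFalse-just f)
    ... | inj₂ f with k , _ , both ← find (Any.any⁻ _ (allFin m) f) with ik , kj ← Equivalence.to T-∧ both =
      triangle-free (adjacent-sound i k ik) (adjacent-sound k j kj)

    set-sound : ∀ b i j → Agrees b (x i) (x j) → Realizes x (set b s i j)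
    set-sound b i j ag = record { injective = injective ; agrees = agrees′ }
      where
      agrees′ : ∀ k l {c} → entry (set b s i j) k l ≡ just c → Agrees c (x k) (x l)
      agrees′ k l eq with entry-set b s i j k l
      ... | inj₁ eq′                         = agrees k l (trans (sym eq′) eq)
      ... | inj₂ (eq′ , pos) with trans (sym eq′) eq
      agrees′ k l eq | inj₂ (eq′ , inj₁ (refl , refl)) | refl = ag
      agrees′ k l eq | inj₂ (eq′ , inj₂ (refl , refl)) | refl = Agrees-sym b ag

    link-sound : ∀ b i j → Agrees b (x i) (x j) → ∃[ s′ ] (link b s i j ≡ just s′ × Realizes x s′)
    link-sound true i j adj with apart s i j in eq
    ... | false = _ , refl , set-sound true i j adj
    ... | true  = contradiction adj (apart-sound i j (Equivalence.from T-≡ eq))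
    link-sound false i j ¬adj with adjacent s i j in eq
    ... | false = _ , refl , set-sound false i j ¬adj
    ... | true  = contradiction (adjacent-sound i j (Equivalence.from T-≡ eq)) ¬adj

    ◂-sound : ∀ {v} → (∀ i → x i ≢ v) → Realizes (v ◂ x) (replicate m nothing ∷ s)
    ◂-sound {v} miss = record { injective = ◂-injective miss injective ; agrees = agrees′ }
      where
      agrees′ : ∀ i j {b} → entry (replicate m nothing ∷ s) i j ≡ just b → Agrees b ((v ◂ x) i) ((v ◂ x) j)
      agrees′ zero    zero    refl = irrefl refl
      agrees′ zero    (suc j) eq   = contradiction (trans (sym (lookup-replicate j nothing)) eq) λ ()
      agrees′ (suc i) zero    eq   = contradiction (trans (sym (lookup-replicate i nothing)) eq) λ ()
      agrees′ (suc i) (suc j) eq   = agrees i j eq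

  Meets : (Fin m → Fin n) → Fin n → Constraints m → Set
  Meets x v = All λ (i , b) → Agrees b (x i) v

  impose-sound : {x : Fin m → Fin n} {s : State m} → Realizes x s → ∀ k c → Meets x (x k) c →
                 ∃[ s′ ] (impose s k c ≡ just s′ × Realizes x s′)
  impose-sound real k []            []         = _ , refl , real
  impose-sound {s = s} real k ((i , b) ∷ c) (ag ∷ meets)
    with link b s i k | link-sound real b i k ag
  ... | _ | s′ , refl , real′ = impose-sound real′ k c meets

  module _ (d : ℕ) (noStar : Refuted (star d)) where

    open Checker n d

    known-sound : ∀ (s : State m) i j → T (known s) → T (adjacent s i j) ⊎ T (apart s i j)
    known-sound {m} s i j ks = Equivalence.to T-∨
      (All.lookup (All.all⁺ _ (allFin m) (All.lookup (All.all⁺ _ (allFin m) ks) (∈-allFin i))) (∈-allFin j))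

    -- The first `d` known neighbours of `i`, together with `x i` as centre, realise the excluded
    -- star.
    crowded-sound : {s : State m} → ∀ i → T (d ≤ᵇ length (filterᵇ (adjacent s i) (allFin m))) → Refuted s
    crowded-sound {m} {s} i d≤ {x} real = noStar record
      { injective = ◂-injective ≢i y-injective ; agrees = agrees′ }
      where
      open Realizes real

      nbrs = filterᵇ (adjacent s i) (allFin m)

      y : Fin d → Fin n
      y j = x (List.lookup nbrs (inject≤ j (ℕ.≤ᵇ⇒≤ d _ d≤)))

      y-adj : ∀ j → Adj (x i) (y j)
      y-adj j = adjacent-sound real i _ (proj₂ (∈-filter⁻ (T? ∘ adjacent s i) {xs = allFin m} (∈-lookup _)))

      ≢i : ∀ j → y j ≢ x i
      ≢i j eq = irrefl (sym eq) (y-adj j)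

      y-injective : Injective _≡_ _≡_ y
      y-injective eq = Fin.inject≤-injective _ _ _ _
        (lookup-injective (Unique.filter⁺ (T? ∘ adjacent s i) (Unique.allFin⁺ m)) (injective eq))

      agrees′ : ∀ j k {b} → entry (star d) j k ≡ just b → Agrees b ((x i ◂ y) j) ((x i ◂ y) k)
      agrees′ zero    zero    refl = irrefl refl
      agrees′ zero    (suc k) eq with refl ← trans (sym (lookup-replicate k (just true))) eq = y-adj k
      agrees′ (suc j) zero    eq with refl ← trans (sym (lookup-replicate j (just true))) eq =
        Adj-sym (y-adj j)
      agrees′ (suc j) (suc k) eq with refl , refl ← entry-blank d j k eq = irrefl refl

    -- Once all vertices are named, `x` is a bijection, and a complete table determines adjacency.
    -- An induced path of the graph through the three vertices then carries over to the table, where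
    -- the search has ruled it out.
    stuck-sound : {s : State m} → T (n ≤ᵇ m) → ∀ a b c → a ≢ b → a ≢ c → b ≢ c → T (known s) →
                  T (PathSearch.uncovered (adjacent s) a b c) → Refuted s
    stuck-sound {m} {s} n≤m a b c a≢b a≢c b≢c ks check {x} real =
      ¬¬covered (a≢b ∘ injective) (a≢c ∘ injective) (b≢c ∘ injective) λ cov →
        PathSearch.uncovered-sound (adjacent s) (λ i adj → irrefl refl (adjacent-sound real i i adj)) check
          (Equivalence.to ≡-Covered (Covered-map⁺ index index-injective preserves reflects cov))
      where
      open Realizes real
      preimage = injective⇒surjective (ℕ.≤ᵇ⇒≤ n m n≤m) x injective

      index : Fin n → Fin m
      index = proj₁ ∘ preimage

      x-index : ∀ v → x (index v) ≡ v
      x-index = proj₂ ∘ preimage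

      index-injective : Injective _≡_ _≡_ index
      index-injective {u} {v} eq = trans (sym (x-index u)) (trans (cong x eq) (x-index v))

      preserves : ∀ {u v} → Adj u v → T (adjacent s (index u) (index v))
      preserves {u} {v} adj with known-sound s (index u) (index v) ks
      ... | inj₁ yes-adj = yes-adj
      ... | inj₂ ap =
        contradiction adj (subst₂ (λ u v → ¬ Adj u v) (x-index u) (x-index v) (apart-sound real _ _ ap))

      reflects : ∀ {u v} → T (adjacent s (index u) (index v)) → Adj u v
      reflects {u} {v} adj = subst₂ Adj (x-index u) (x-index v) (adjacent-sound real _ _ adj)

      index-x : ∀ i → index (x i) ≡ i
      index-x i = injective (x-index (x i))

      ≡-Covered : InducedPaths.Covered (λ i j → T (adjacent s i j))
                    (index (x a)) (index (x b)) (index (x c)) ⇔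
                  InducedPaths.Covered (λ i j → T (adjacent s i j)) a b c
      ≡-Covered rewrite index-x a | index-x b | index-x c = mk⇔ id id

    refute-sound  : ∀ p (s : State (suc m)) → T (refute p s) → Refuted s
    -- The last hypothesis is the invariant of the recursion: if `v` has already been named, its
    -- name is among the remaining candidates. With no candidate left, `v` is new.
    witness-sound : ∀ ps (s : State (suc m)) ks c → T (witness ps s ks c) → ∀ {x} → Realizes x s →
                    ∀ {v} → Meets x v c → ¬ (∀ i → x i ≡ v → i ∈ ks)
    old-sound     : ∀ ps (s : State (suc m)) ks c {e s′} → e ≡ just s′ → T (old ps e s ks c) → Refuted s′
    new-sound     : ∀ ps {e} {s : State (suc m)} → e ≡ just s → T (new ps e) → Refuted s
    alternative-sound : ∀ p {e} {s : State (suc m)} → e ≡ just s → T (alternative p e) → Refuted s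

    refute-sound (common i j ps) s check real with ap , rest ← Equivalence.to T-∧ check
      with i≠j , ws ← Equivalence.to T-∧ rest
      with w , iw , jw ← commonNeighbour
        (T-not⁻ i≠j ∘ ≡⇒== _ _ ∘ Realizes.injective real) (apart-sound real _ _ ap)
      = witness-sound ps s _ _ ws real (iw ∷ jw ∷ []) (λ k _ → ∈-allFin k)
    refute-sound (exclusive i j k ps) s check real with ij , rest ← Equivalence.to T-∧ check
      with ki , ws ← Equivalence.to T-∧ rest
      with ij-apart , i≠j ← Equivalence.to T-∧ ij
      with ki-apart , k≠ ← Equivalence.to T-∧ ki
      with k≠i , k≠j ← Equivalence.to T-∧ k≠
      with w , iw , jw ← exclusiveNeighbour
        (T-not⁻ i≠j ∘ ≡⇒== _ _ ∘ Realizes.injective real) (apart-sound real _ _ ij-apart)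
        (T-not⁻ k≠i ∘ ≡⇒== _ _ ∘ Realizes.injective real)
        (T-not⁻ k≠j ∘ ≡⇒== _ _ ∘ Realizes.injective real) (apart-sound real _ _ ki-apart)
      = witness-sound ps s _ _ ws real (iw ∷ jw ∷ []) (λ k _ → ∈-allFin k)
    refute-sound (fresh p) s check {x} real with m<n , rest ← Equivalence.to T-∧ check
      with v , miss ← missed (ℕ.<ᵇ⇒< _ n m<n) x = refute-sound p _ rest (◂-sound real miss)
    refute-sound (split i j p q) s check {x} real
      with ps , qs ← Equivalence.to (T-∧ {alternative p (link true s (# i) (# j))}) check
      with adj? (x (# i)) (x (# j))
    ... | yes adj =
      let s′ , eq , real′ = link-sound real true (# i) (# j) adj in alternative-sound p eq ps real′
    ... | no ¬adj =
      let s′ , eq , real′ = link-sound real false (# i) (# j) ¬adj in alternative-sound q eq qs real′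
    refute-sound (crowded i) s check real = crowded-sound (# i) check real
    refute-sound (stuck a b c) s check real with n≤m , rest ← Equivalence.to T-∧ check
      with distinct , rest′ ← Equivalence.to T-∧ rest
      with a≠b , rest″ ← Equivalence.to T-∧ distinct
      with a≠c , b≠c ← Equivalence.to T-∧ rest″
      with ks , search ← Equivalence.to T-∧ rest′
      = stuck-sound n≤m (# a) (# b) (# c)
          (T-not⁻ a≠b ∘ ≡⇒== _ _) (T-not⁻ a≠c ∘ ≡⇒== _ _) (T-not⁻ b≠c ∘ ≡⇒== _ _)
          ks search real

    witness-sound {m} ps s [] c check real {v} meets names with Equivalence.to T-∨ check
    ... | inj₁ m≮n = T-not⁻ m≮n (ℕ.<⇒<ᵇ (Fin.injective⇒≤
      (◂-injective (λ i eq → contradiction (names i eq) λ ()) (Realizes.injective real))))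
    ... | inj₂ rest =
      let s′ , eq , real′ = impose-sound (◂-sound real λ i eq → contradiction (names i eq) λ ())
                              zero (later c) (All.map⁺ meets)
      in new-sound ps eq rest real′
    witness-sound ps s (k ∷ ks) c check {x} real {v} meets names with x k Fin.≟ v
    ... | yes refl = let s′ , eq , real′ = impose-sound real k c meets in old-sound ps s ks c eq check real′
    witness-sound ps s (k ∷ ks) c check {x} real {v} meets names | no xk≢v =
      skip ps (impose s k c) check
      where
      names′ : ∀ i → x i ≡ v → i ∈ ks
      names′ i eq = Any.tail (λ { refl → xk≢v eq }) (names i eq)

      skip : ∀ ps s′ → T (old ps s′ s ks c) → ⊥
      skip ps       nothing   check = witness-sound ps s ks c check real meets names′
      skip (p ∷ ps) (just s′) check =
        witness-sound ps s ks c (proj₂ (Equivalence.to (T-∧ {refute p s′}) check)) real meets names′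

    old-sound (p ∷ ps) s ks c {s′ = s′} refl check =
      refute-sound p s′ (proj₁ (Equivalence.to (T-∧ {refute p s′}) check))

    new-sound []      refl ()
    new-sound (p ∷ _) eq check = alternative-sound p eq check

    alternative-sound p {s = s} refl check = refute-sound p s check

-- Consequences of position number 2 and diameter 2

module _ {n} (G : Graph n) where

  open Graph G renaming (sym to Adj-sym)
  open InducedPathProperties {_~_ = Adj} irrefl Adj-sym
  open MonophonicPosition G

  diameter2⇒commonNeighbour : HasDiameter G 2 → ∀ {u v} → u ≢ v → ¬ Adj u v → ∃[ w ] (Adj u w × Adj v w)
  diameter2⇒commonNeighbour (close , _) {u} {v} u≢v u≁v with close u v
  ... | _ , ([]            , _) , _ = contradiction refl u≢v
  ... | _ , (uv ∷ []       , _) , _ = contradiction uv u≁v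
  ... | _ , (uw ∷ wv ∷ []  , _) , _ = _ , uw , Adj-sym wv
  ... | _ , (_ ∷ _ ∷ _ ∷ _ , _) , s≤s (s≤s ())

  obstructionFree : HasMonophonicPositionNumber G 2 → HasDiameter G 2 → ObstructionFree G
  obstructionFree number diameter = record
    { triangle-free      = triangle-free
    ; commonNeighbour    = commonNeighbour
    ; exclusiveNeighbour = exclusiveNeighbour
    ; ¬¬covered          = number≡2⇒¬¬covered number
    }
    where
    commonNeighbour : ∀ {u v} → u ≢ v → ¬ Adj u v → ∃[ w ] (Adj u w × Adj v w)
    commonNeighbour = diameter2⇒commonNeighbour diameter

    triangle-free : ∀ {u v w} → Adj u v → Adj v w → ¬ Adj u w
    triangle-free uv vw uw = number≡2⇒¬¬covered number
      (λ { refl → irrefl refl uv }) (λ { refl → irrefl refl uw }) (λ { refl → irrefl refl vw })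
      (triangle-uncovered uv vw (Adj-sym uw))

    exclusiveNeighbour : ∀ {u v w} → u ≢ v → ¬ Adj u v → w ≢ u → w ≢ v → ¬ Adj w u →
      ∃[ x ] (Adj u x × ¬ Adj v x)
    exclusiveNeighbour {u} {v} {w} u≢v u≁v w≢u w≢v w≁u
      with Fin.any? (λ x → adj? u x ×-dec ¬? (adj? v x))
    ... | yes found = found
    ... | no  none  = contradiction
      (twins-uncovered u≢v u≁v N[u]⊆N[v] N[v]⊆N[u] w≢u w≢v (w≁u ∘ Adj-sym))
      (number≡2⇒¬¬covered number u≢v (≢-sym w≢u) (≢-sym w≢v))
      where
      N[u]⊆N[v] : ∀ {x} → Adj u x → Adj v x
      N[u]⊆N[v] {x} ux = decidable-stable (adj? v x) λ v≁x → none (x , ux , v≁x)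

      -- Otherwise a common neighbour of u and x ∈ N(v) closes a triangle with v.
      N[v]⊆N[u] : ∀ {x} → Adj v x → Adj u x
      N[v]⊆N[u] {x} vx = decidable-stable (adj? u x) λ u≁x →
        let y , uy , xy = commonNeighbour (λ { refl → u≁v (Adj-sym vx) }) u≁x in
        triangle-free vx xy (N[u]⊆N[v] uy)

-- Exclusion of the orders 6, 7, 9 and 10

module _ {n} {G : Graph n} (free : ObstructionFree G) where

  open Graph G using (irrefl)
  open Soundness G free

  -- This star has `n + 1` vertices. It starts the descent on degrees: the first case analysis runs
  -- with `d` equal to `n`.
  star-refuted : Refuted (star n)
  star-refuted real = ℕ.n≮n n (Fin.injective⇒≤ (Realizes.injective real))

  vertex-unrefuted : Fin n → ¬ Refuted (blank 1)
  vertex-unrefuted v refuted = refuted {const v} record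
    { injective = λ { {zero} {zero} _ → refl }
    ; agrees    = λ { zero zero refl → irrefl refl }
    }

  -- First a star K₁,₄ is excluded, then K₁,₃, and finally a single vertex.
  contradictory : (p₄ p₃ p₁ : Plan) → T (Checker.refute n n p₄ (star 4)) →
                  T (Checker.refute n 4 p₃ (star 3)) → T (Checker.refute n 3 p₁ (blank 1)) → ¬ Fin n
  contradictory p₄ p₃ p₁ t₄ t₃ t₁ v = vertex-unrefuted v
    (refute-sound 3 (refute-sound 4 (refute-sound n star-refuted p₄ _ t₄) p₃ _ t₃) p₁ _ t₁)

-- With degrees at most 2, a vertex reaches at most 1 + 2 + 2 vertices within distance 2. Six
-- vertices are already too many, so one plan serves all four orders.
plan₀ : Plan
plan₀ =
  fresh (split 0 1 (fresh (split 0 2 (fresh (split 0 3 (crowded 3) (split 0 2 (split 0 1 (fresh (split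
  0 4 (crowded 4) (exclusive 4 1 0 (crowded 5 ∷ [])))) (exclusive 1 2 0 (common 3 0 (fresh (split 0 5
  (crowded 5) (common 5 0 (crowded 3 ∷ crowded 4 ∷ crowded 6 ∷ []))) ∷ crowded 4 ∷ []) ∷ [])))
  (exclusive 2 1 0 (common 4 1 (common 3 1 (fresh (split 0 5 (crowded 5) (common 5 0 (crowded 3 ∷
  crowded 4 ∷ crowded 6 ∷ []))) ∷ crowded 4 ∷ []) ∷ crowded 5 ∷ []) ∷ []))))) (split 0 1 (fresh (split
  0 2 (crowded 2) (split 0 3 (split 0 1 (fresh (split 0 4 (crowded 4) (exclusive 4 2 0 (crowded 5 ∷
  [])))) (exclusive 1 3 0 (common 4 0 (fresh (split 0 5 (crowded 5) (common 5 0 (crowded 2 ∷ crowded 4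
  ∷ crowded 6 ∷ []))) ∷ crowded 5 ∷ []) ∷ []))) (exclusive 3 1 0 (common 4 1 (common 3 1 (fresh (split
  0 5 (crowded 5) (common 5 0 (crowded 1 ∷ crowded 4 ∷ crowded 6 ∷ []))) ∷ crowded 4 ∷ []) ∷ crowded 5
  ∷ []) ∷ []))))) (common 2 0 (common 2 1 (fresh (split 0 5 (crowded 5) (common 5 0 (crowded 2 ∷
  crowded 4 ∷ crowded 6 ∷ []))) ∷ []) ∷ []))))) (common 1 0 (fresh (split 0 1 (crowded 1) (split 0 3
  (split 0 2 (fresh (split 0 4 (crowded 4) (exclusive 4 3 0 (crowded 5 ∷ [])))) (exclusive 2 3 0
  (common 4 0 (fresh (split 0 5 (crowded 5) (common 5 0 (crowded 2 ∷ crowded 3 ∷ crowded 6 ∷ []))) ∷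
  crowded 5 ∷ []) ∷ []))) (exclusive 3 2 0 (common 4 1 (common 3 0 (fresh (split 0 5 (crowded 5)
  (common 5 0 (crowded 1 ∷ crowded 3 ∷ crowded 6 ∷ []))) ∷ crowded 1 ∷ []) ∷ crowded 5 ∷ []) ∷ []))))
  ∷ [])))

-- The subscript of a plan is the number of leaves of the star that it refutes. For the orders 6 and
-- 7 no branch reaches `stuck`: triangles, common neighbours and exclusive neighbours suffice, and
-- an empty list of subplans marks a required vertex that cannot exist.
plan6₃ : Plan
plan6₃ =
  exclusive 3 2 1 (exclusive 3 4 2 (exclusive 5 3 4 (exclusive 3 4 5 [] ∷ []) ∷ []) ∷ [])

plan6₄ : Plan
plan6₄ =
  exclusive 4 3 2 (exclusive 4 5 3 [] ∷ [])

plan7₃ : Plan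
plan7₃ =
  exclusive 3 2 1 (exclusive 3 4 2 (split 1 3 (exclusive 5 3 4 (common 5 2 (exclusive 4 6 5 [] ∷ []) ∷
  [])) (exclusive 3 4 5 (exclusive 5 4 6 (common 5 2 (common 5 0 (common 4 2 [] ∷ []) ∷ []) ∷ []) ∷
  [])) ∷ []) ∷ [])

plan7₄ : Plan
plan7₄ =
  exclusive 4 3 2 (exclusive 4 5 3 (exclusive 6 4 5 (exclusive 4 5 6 [] ∷ []) ∷ []) ∷ [])

plan9₃ : Plan
plan9₃ =
  exclusive 3 2 1 (exclusive 3 4 2 (split 1 3 (exclusive 5 3 4 (split 1 4 (common 5 2 (common 7 2
  (split 0 1 (fresh (split 0 8 (crowded 8) (common 8 0 (crowded 2 ∷ crowded 4 ∷ crowded 5 ∷ []))))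
  (common 1 0 (split 0 6 (crowded 6) (common 6 0 (crowded 5 ∷ [])) ∷ [])) ∷ crowded 8 ∷ []) ∷ []))
  (exclusive 4 6 5 (common 7 0 (split 1 2 (common 5 2 (split 0 6 (fresh (split 0 8 (crowded 8) (common
  8 0 (crowded 2 ∷ crowded 4 ∷ crowded 5 ∷ [])))) (common 6 0 (split 0 8 (crowded 8) (common 8 0
  (crowded 4 ∷ [])) ∷ [])) ∷ crowded 6 ∷ [])) (common 7 2 (split 0 6 (common 2 1 (split 0 6 (crowded
  6) (common 6 0 (crowded 5 ∷ [])) ∷ [])) (split 1 6 (split 0 2 (fresh (split 0 8 (crowded 8) (common
  8 0 (crowded 2 ∷ crowded 4 ∷ crowded 5 ∷ [])))) (common 2 0 (split 0 8 (crowded 8) (common 8 0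
  (crowded 5 ∷ [])) ∷ []))) (common 6 1 (common 7 1 (split 0 6 (crowded 6) (common 6 0 (crowded 4 ∷
  [])) ∷ []) ∷ []))) ∷ crowded 8 ∷ [])) ∷ crowded 8 ∷ []) ∷ [])) ∷ [])) (exclusive 3 4 5 (split 1 4
  (exclusive 5 4 6 (common 6 1 (split 1 3 (common 6 3 (split 0 7 (fresh (split 0 8 (crowded 8) (common
  8 0 (crowded 1 ∷ crowded 4 ∷ crowded 5 ∷ [])))) (common 7 0 (split 0 6 (crowded 6) (common 6 0
  (crowded 3 ∷ [])) ∷ [])) ∷ crowded 7 ∷ [])) (common 5 3 (split 0 7 (common 3 1 (split 0 7 (crowded
  7) (common 7 0 (crowded 5 ∷ [])) ∷ [])) (split 1 7 (split 0 3 (fresh (split 0 8 (crowded 8) (common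
  8 0 (crowded 2 ∷ crowded 4 ∷ crowded 5 ∷ [])))) (common 3 0 (split 0 6 (crowded 6) (common 6 0
  (crowded 5 ∷ [])) ∷ []))) (common 7 1 (common 8 1 (split 0 7 (crowded 7) (common 7 0 (crowded 3 ∷
  [])) ∷ []) ∷ []))) ∷ crowded 6 ∷ [])) ∷ crowded 7 ∷ []) ∷ [])) (split 1 2 (split 0 2 (common 5 0
  (common 5 2 (split 1 8 (split 0 8 (crowded 8) (common 8 0 (crowded 1 ∷ []))) (common 8 1 (crowded 0
  ∷ [])) ∷ []) ∷ [])) (common 4 2 (common 5 2 (split 1 7 (split 0 6 (fresh (split 0 8 (crowded 8)
  (common 8 0 (crowded 2 ∷ crowded 4 ∷ crowded 5 ∷ [])))) (common 6 0 (split 0 8 (crowded 8) (common 8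
  0 (crowded 2 ∷ [])) ∷ []))) (common 7 1 (split 1 7 (split 0 7 (crowded 7) (common 7 0 (crowded 1 ∷
  []))) (common 7 1 (crowded 0 ∷ [])) ∷ [])) ∷ crowded 6 ∷ []) ∷ []))) (common 5 2 (split 1 7 (common
  3 2 (common 8 3 (split 1 2 (crowded 2) (common 2 1 (split 0 6 (crowded 6) (common 6 0 (crowded 5 ∷
  [])) ∷ [])) ∷ []) ∷ [])) (common 7 2 (common 4 3 (split 1 6 (split 0 6 (crowded 6) (common 6 0
  (crowded 1 ∷ []))) (common 6 1 (crowded 0 ∷ [])) ∷ []) ∷ [])) ∷ []))) ∷ [])) ∷ []) ∷ [])

plan9₄ : Plan
plan9₄ =
  exclusive 4 3 2 (exclusive 4 5 3 (split 1 4 (exclusive 6 4 5 (split 1 5 (common 6 2 (common 8 2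
  (split 3 5 (exclusive 8 5 7 (exclusive 5 6 8 [] ∷ [])) (exclusive 5 7 8 (exclusive 5 8 7 (stuck 8 6
  0 ∷ []) ∷ [])) ∷ []) ∷ [])) (exclusive 5 7 6 (common 8 0 (common 7 3 (split 3 5 (exclusive 8 5 7
  (exclusive 5 6 8 [] ∷ [])) (common 5 3 (split 1 7 (exclusive 7 5 8 (exclusive 5 7 8 (stuck 8 7 0 ∷
  []) ∷ [])) (exclusive 7 5 8 (exclusive 5 7 8 (stuck 8 6 2 ∷ []) ∷ [])) ∷ [])) ∷ []) ∷ []) ∷ [])) ∷
  [])) (exclusive 4 5 6 (split 1 5 (exclusive 6 5 7 (common 8 2 (common 7 1 (split 2 5 (exclusive 7 5
  8 (exclusive 5 6 8 [] ∷ [])) (common 5 2 (split 1 8 (exclusive 8 5 7 (exclusive 5 8 7 (stuck 8 6 0 ∷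
  []) ∷ [])) (exclusive 8 5 7 (exclusive 5 8 7 (stuck 8 7 1 ∷ []) ∷ [])) ∷ [])) ∷ []) ∷ []) ∷ []))
  (split 1 4 (exclusive 6 4 7 (common 6 2 (exclusive 5 7 8 (common 8 2 (common 7 3 (exclusive 6 8 7
  (stuck 8 6 2 ∷ []) ∷ []) ∷ []) ∷ []) ∷ []) ∷ [])) (split 0 4 (exclusive 5 4 7 (common 7 1 (exclusive
  5 8 7 (common 8 1 (exclusive 5 6 8 [] ∷ []) ∷ []) ∷ []) ∷ [])) (exclusive 4 7 6 (split 3 5
  (exclusive 8 5 7 (common 6 3 [] ∷ [])) (exclusive 5 7 8 (common 7 3 (common 7 1 (common 7 0 (common
  8 0 [] ∷ []) ∷ []) ∷ []) ∷ [])) ∷ [])))) ∷ [])) ∷ []) ∷ [])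

-- Here the bound 1 + 3 + 6 is attained, so the Petersen graph has to be refuted by coverage. By the
-- time all vertices are named, 9, 8 and 7 are the leaves of the initial star: `stuck 9 8 7` says
-- that the three neighbours of its centre lie on no common induced path.
plan10₃ : Plan
plan10₃ =
  exclusive 3 2 1 (exclusive 3 4 2 (split 1 3 (exclusive 5 3 4 (split 1 4 (common 5 2 (common 7 2
  (split 0 1 (fresh (split 0 8 (crowded 8) (common 8 0 (crowded 2 ∷ crowded 4 ∷ crowded 5 ∷ crowded 9
  ∷ [])))) (common 1 0 (split 0 6 (crowded 6) (common 6 0 (crowded 5 ∷ crowded 7 ∷ [])) ∷ [])) ∷
  crowded 8 ∷ []) ∷ [])) (exclusive 4 6 5 (common 7 0 (split 1 2 (common 5 2 (split 0 6 (fresh (split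
  0 8 (crowded 8) (common 8 0 (crowded 2 ∷ crowded 4 ∷ crowded 5 ∷ crowded 9 ∷ [])))) (common 6 0
  (split 0 8 (crowded 8) (common 8 0 (crowded 4 ∷ crowded 9 ∷ [])) ∷ [])) ∷ crowded 6 ∷ [])) (common 7
  2 (split 0 6 (common 2 1 (split 0 6 (crowded 6) (common 6 0 (crowded 5 ∷ crowded 7 ∷ [])) ∷ []))
  (split 1 6 (split 0 2 (fresh (split 0 8 (crowded 8) (common 8 0 (crowded 2 ∷ crowded 4 ∷ crowded 5 ∷
  crowded 9 ∷ [])))) (common 2 0 (split 0 8 (crowded 8) (common 8 0 (crowded 5 ∷ crowded 9 ∷ [])) ∷
  []))) (common 6 1 (common 7 1 (split 0 6 (crowded 6) (common 6 0 (crowded 4 ∷ crowded 7 ∷ [])) ∷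
  crowded 8 ∷ []) ∷ []))) ∷ crowded 8 ∷ [])) ∷ crowded 8 ∷ []) ∷ [])) ∷ [])) (exclusive 3 4 5 (split 1
  4 (exclusive 5 4 6 (common 6 1 (split 1 3 (common 6 3 (split 0 7 (fresh (split 0 8 (crowded 8)
  (common 8 0 (crowded 1 ∷ crowded 4 ∷ crowded 5 ∷ crowded 9 ∷ [])))) (common 7 0 (split 0 6 (crowded
  6) (common 6 0 (crowded 3 ∷ crowded 7 ∷ [])) ∷ [])) ∷ crowded 7 ∷ [])) (common 5 3 (split 0 7
  (common 3 1 (split 0 7 (crowded 7) (common 7 0 (crowded 5 ∷ crowded 8 ∷ [])) ∷ [])) (split 1 7
  (split 0 3 (fresh (split 0 8 (crowded 8) (common 8 0 (crowded 2 ∷ crowded 4 ∷ crowded 5 ∷ crowded 9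
  ∷ [])))) (common 3 0 (split 0 6 (crowded 6) (common 6 0 (crowded 5 ∷ crowded 7 ∷ [])) ∷ [])))
  (common 7 1 (common 8 1 (split 0 7 (crowded 7) (common 7 0 (crowded 3 ∷ crowded 8 ∷ [])) ∷ crowded 9
  ∷ []) ∷ []))) ∷ crowded 6 ∷ [])) ∷ crowded 7 ∷ []) ∷ [])) (split 1 2 (split 0 2 (common 5 0 (common
  5 2 (split 1 8 (split 0 8 (crowded 8) (common 8 0 (crowded 1 ∷ crowded 9 ∷ []))) (common 8 1
  (crowded 0 ∷ split 1 9 (crowded 9) (common 9 1 (stuck 9 8 7 ∷ [])) ∷ [])) ∷ []) ∷ [])) (common 4 2
  (common 5 2 (split 1 7 (split 0 6 (fresh (split 0 8 (crowded 8) (common 8 0 (crowded 2 ∷ crowded 4 ∷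
  crowded 5 ∷ crowded 9 ∷ [])))) (common 6 0 (split 0 8 (crowded 8) (common 8 0 (crowded 2 ∷ crowded 9
  ∷ [])) ∷ []))) (common 7 1 (split 1 7 (split 0 7 (crowded 7) (common 7 0 (crowded 1 ∷ crowded 8 ∷
  []))) (common 7 1 (crowded 0 ∷ split 1 8 (crowded 8) (common 8 1 (stuck 9 8 7 ∷ [])) ∷ [])) ∷ [])) ∷
  crowded 6 ∷ []) ∷ []))) (common 5 2 (split 1 7 (common 3 2 (common 8 3 (split 1 2 (crowded 2)
  (common 2 1 (split 0 6 (crowded 6) (common 6 0 (crowded 5 ∷ crowded 7 ∷ [])) ∷ crowded 3 ∷ [])) ∷
  crowded 9 ∷ []) ∷ [])) (common 7 2 (split 2 4 (common 7 2 (split 1 6 (split 0 6 (crowded 6) (common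
  6 0 (crowded 1 ∷ crowded 7 ∷ []))) (common 6 1 (crowded 0 ∷ split 1 7 (crowded 7) (common 7 1 (stuck
  9 8 7 ∷ [])) ∷ [])) ∷ crowded 8 ∷ [])) (common 4 3 (common 9 3 (common 8 3 (common 7 5 (stuck 9 8 7
  ∷ []) ∷ []) ∷ []) ∷ [])) ∷ [])) ∷ []))) ∷ [])) ∷ []) ∷ [])

plan10₄ : Plan
plan10₄ =
  exclusive 4 3 2 (exclusive 4 5 3 (split 1 4 (exclusive 6 4 5 (split 1 5 (common 6 2 (split 1 7
  (common 8 2 (common 7 2 [] ∷ [])) (split 3 5 (split 2 5 (exclusive 6 5 8 (common 9 3 (exclusive 6 7
  9 [] ∷ []) ∷ [])) (exclusive 5 8 7 (exclusive 9 6 8 (common 9 3 (common 9 0 (common 6 3 [] ∷ []) ∷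
  []) ∷ []) ∷ []))) (split 1 5 (split 2 5 (common 8 2 (common 7 2 [] ∷ [])) (split 1 2 (split 0 1
  (exclusive 5 8 7 (common 9 0 (split 0 8 (stuck 9 7 0) (common 8 0 (stuck 9 8 6 ∷ [])) ∷ []) ∷ []))
  (split 0 5 (fresh (split 0 9 (split 0 7 (exclusive 4 0 8 (exclusive 0 5 4 [] ∷ [])) (common 7 0
  (exclusive 2 0 8 (common 6 0 (stuck 8 7 2 ∷ []) ∷ []) ∷ []))) (split 0 7 (common 9 0 (exclusive 3 0
  9 (common 8 0 (stuck 9 6 3 ∷ []) ∷ []) ∷ [])) (split 0 4 (split 0 8 (exclusive 1 0 9 (common 6 0
  (stuck 9 7 1 ∷ []) ∷ [])) (split 0 6 (common 8 0 (stuck 9 7 1 ∷ [])) (exclusive 0 9 8 (exclusive 0 7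
  9 [] ∷ [])))) (common 4 0 (exclusive 0 8 9 (exclusive 0 6 9 [] ∷ []) ∷ [])))))) (exclusive 5 8 7
  (common 2 1 [] ∷ [])))) (common 8 2 (common 7 2 [] ∷ [])))) (exclusive 5 7 8 (split 3 6 (common 9 3
  (exclusive 8 6 9 (common 8 0 (common 6 4 [] ∷ []) ∷ []) ∷ [])) (common 6 3 (common 7 2 (common 6 2
  (split 0 9 (stuck 8 7 0) (common 9 0 (stuck 9 8 6 ∷ [])) ∷ []) ∷ []) ∷ [])) ∷ [])))) ∷ []))
  (exclusive 5 7 6 (split 2 3 (split 3 5 (split 1 5 (exclusive 8 5 7 (common 7 2 (exclusive 6 9 8 [] ∷
  []) ∷ [])) (exclusive 5 6 8 (exclusive 7 6 9 (common 7 2 (common 7 0 (common 6 2 [] ∷ []) ∷ []) ∷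
  []) ∷ []))) (split 2 5 (split 1 7 (split 0 7 (common 8 0 (common 7 2 [] ∷ [])) (split 1 5 (exclusive
  7 5 8 (common 7 2 (exclusive 6 8 9 [] ∷ []) ∷ [])) (split 0 5 (split 0 1 (fresh (split 0 9 (split 0
  8 (exclusive 2 0 7 (exclusive 0 5 4 [] ∷ [])) (common 8 0 (exclusive 4 0 8 (common 7 0 (stuck 8 6 4
  ∷ []) ∷ []) ∷ []))) (split 0 8 (common 9 0 (exclusive 3 0 9 (common 6 0 (stuck 9 7 3 ∷ []) ∷ []) ∷
  [])) (split 0 2 (split 0 7 (exclusive 1 0 9 (common 6 0 (stuck 9 8 1 ∷ []) ∷ [])) (split 0 6 (common
  7 0 (stuck 9 8 1 ∷ [])) (exclusive 0 9 8 (exclusive 0 8 9 [] ∷ [])))) (common 2 0 (exclusive 0 7 9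
  (exclusive 0 6 9 [] ∷ []) ∷ [])))))) (common 8 0 (common 7 2 [] ∷ []))) (exclusive 5 7 8 (common 8 0
  (common 9 1 (common 6 1 (split 0 7 (stuck 9 8 0) (common 7 0 (stuck 9 7 6 ∷ [])) ∷ []) ∷ []) ∷ []) ∷
  []))))) (split 0 7 (split 1 5 (split 0 5 (common 8 0 (exclusive 8 6 9 [] ∷ [])) (split 0 1 (fresh
  (split 0 9 (split 0 7 (exclusive 4 0 8 (exclusive 0 5 4 [] ∷ [])) (common 7 0 (exclusive 2 0 8
  (common 6 0 (stuck 8 7 2 ∷ []) ∷ []) ∷ []))) (split 0 7 (common 9 0 (exclusive 1 0 9 (common 8 0
  (stuck 9 6 1 ∷ []) ∷ []) ∷ [])) (split 0 4 (split 0 8 (exclusive 3 0 9 (common 6 0 (stuck 9 7 3 ∷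
  []) ∷ [])) (split 0 6 (common 8 0 (stuck 9 7 3 ∷ [])) (exclusive 0 9 8 (exclusive 0 7 9 [] ∷ []))))
  (common 4 0 (exclusive 0 8 9 (exclusive 0 6 9 [] ∷ []) ∷ [])))))) (common 8 0 (common 8 2 [] ∷
  [])))) (exclusive 5 7 8 (exclusive 8 6 9 (common 8 0 (common 7 2 (common 6 2 (split 0 9 (stuck 8 7
  0) (common 9 0 (stuck 9 8 6 ∷ [])) ∷ []) ∷ []) ∷ []) ∷ []) ∷ []))) (exclusive 7 5 8 (split 2 6
  (common 8 2 (common 9 1 (common 8 1 (split 0 7 (stuck 9 6 0) (common 7 0 (stuck 9 8 7 ∷ [])) ∷ []) ∷
  []) ∷ [])) (exclusive 6 8 9 (common 8 1 (common 7 2 (common 8 2 (split 0 9 (stuck 8 6 4) (common 9 0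
  (stuck 9 8 7 ∷ [])) ∷ []) ∷ []) ∷ []) ∷ [])) ∷ [])))) (common 5 3 (common 9 1 (split 2 6 (common 6 3
  (split 1 8 (split 0 8 (stuck 9 7 0) (common 8 0 (stuck 9 8 6 ∷ []))) (common 8 1 (stuck 9 8 7 ∷ []))
  ∷ [])) (common 6 3 (split 2 8 (split 0 8 (stuck 9 7 0) (common 8 0 (stuck 9 8 6 ∷ []))) (common 8 2
  (stuck 9 8 7 ∷ [])) ∷ [])) ∷ []) ∷ [])))) (common 7 3 (common 9 3 (common 9 1 (common 7 3 [] ∷ []) ∷
  []) ∷ [])) ∷ [])) ∷ [])) (exclusive 4 5 6 (split 1 5 (exclusive 6 5 7 (split 2 3 (split 3 5 (split 1
  8 (split 0 8 (common 7 1 (common 7 1 [] ∷ [])) (split 1 5 (exclusive 8 5 7 (common 8 2 (exclusive 6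
  9 8 [] ∷ []) ∷ [])) (split 0 5 (split 0 1 (fresh (split 0 9 (split 0 7 (exclusive 2 0 8 (exclusive 0
  5 4 [] ∷ [])) (common 7 0 (exclusive 4 0 8 (common 6 0 (stuck 8 7 4 ∷ []) ∷ []) ∷ []))) (split 0 7
  (common 9 0 (exclusive 3 0 9 (common 8 0 (stuck 9 6 3 ∷ []) ∷ []) ∷ [])) (split 0 2 (split 0 8
  (exclusive 1 0 9 (common 6 0 (stuck 9 7 1 ∷ []) ∷ [])) (split 0 6 (common 8 0 (stuck 9 7 1 ∷ []))
  (exclusive 0 9 8 (exclusive 0 7 9 [] ∷ [])))) (common 2 0 (exclusive 0 8 9 (exclusive 0 6 9 [] ∷ [])
  ∷ [])))))) (common 8 0 (common 8 2 [] ∷ []))) (exclusive 5 8 7 (common 9 0 (common 7 1 (common 6 1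
  (split 0 8 (stuck 9 7 0) (common 8 0 (stuck 9 8 6 ∷ [])) ∷ []) ∷ []) ∷ []) ∷ []))))) (split 0 8
  (split 1 5 (split 0 5 (exclusive 8 5 7 (common 7 1 [] ∷ [])) (split 0 1 (fresh (split 0 9 (split 0 8
  (exclusive 1 0 7 (exclusive 0 5 4 [] ∷ [])) (common 8 0 (exclusive 4 0 8 (common 6 0 (stuck 8 7 4 ∷
  []) ∷ []) ∷ []))) (split 0 8 (common 9 0 (exclusive 3 0 9 (common 7 0 (stuck 9 6 3 ∷ []) ∷ []) ∷
  [])) (split 0 1 (split 0 7 (exclusive 2 0 9 (common 6 0 (stuck 9 8 2 ∷ []) ∷ [])) (split 0 6 (common
  7 0 (stuck 9 8 2 ∷ [])) (exclusive 0 9 8 (exclusive 0 8 9 [] ∷ [])))) (common 1 0 (exclusive 0 7 9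
  (exclusive 0 6 9 [] ∷ []) ∷ [])))))) (common 8 1 (common 7 1 [] ∷ [])))) (exclusive 5 8 7 (exclusive
  9 6 8 (common 9 0 (common 8 2 (common 6 2 (split 0 7 (stuck 9 8 0) (common 7 0 (stuck 9 7 6 ∷ [])) ∷
  []) ∷ []) ∷ []) ∷ []) ∷ []))) (exclusive 8 5 7 (split 2 6 (common 9 2 (common 7 1 (common 9 1 (split
  0 8 (stuck 9 6 3) (common 8 0 (stuck 9 8 7 ∷ [])) ∷ []) ∷ []) ∷ [])) (exclusive 6 9 8 (common 9 1
  (common 8 2 (common 9 2 (split 0 7 (stuck 9 6 3) (common 7 0 (stuck 9 8 7 ∷ [])) ∷ []) ∷ []) ∷ []) ∷
  [])) ∷ [])))) (split 2 5 (split 1 5 (exclusive 6 5 8 (common 8 2 (exclusive 6 7 9 [] ∷ []) ∷ []))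
  (exclusive 5 7 8 (exclusive 8 6 9 (common 8 2 (common 8 0 (common 6 2 [] ∷ []) ∷ []) ∷ []) ∷ [])))
  (common 5 2 (common 8 2 (split 2 6 (common 6 4 (split 1 9 (split 0 9 (stuck 8 7 0) (common 9 0
  (stuck 9 8 6 ∷ []))) (common 9 1 (stuck 9 8 7 ∷ [])) ∷ [])) (common 6 4 (split 2 9 (split 0 9 (stuck
  8 7 0) (common 9 0 (stuck 9 8 6 ∷ []))) (common 9 2 (stuck 9 8 7 ∷ [])) ∷ [])) ∷ []) ∷ []))))
  (common 8 2 (common 8 4 (common 8 2 (common 7 4 [] ∷ []) ∷ []) ∷ [])) ∷ [])) (split 1 4 (exclusive 6
  4 7 (split 1 5 (common 6 2 (common 8 2 (split 3 4 (common 7 4 (split 1 9 (split 0 9 (stuck 8 6 0)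
  (common 9 0 (stuck 9 8 7 ∷ []))) (common 9 1 (stuck 9 8 7 ∷ [])) ∷ [])) (common 9 3 (common 8 4
  (common 7 4 [] ∷ []) ∷ [])) ∷ []) ∷ [])) (split 3 5 (split 1 8 (split 1 2 (split 0 8 (common 7 3
  (common 6 1 [] ∷ [])) (split 0 6 (split 0 3 (fresh (split 0 9 (split 0 7 (exclusive 2 0 8 (exclusive
  0 5 4 [] ∷ [])) (common 7 0 (exclusive 4 0 8 (common 6 0 (stuck 8 7 4 ∷ []) ∷ []) ∷ []))) (split 0 7
  (common 9 0 (exclusive 1 0 9 (common 8 0 (stuck 9 6 1 ∷ []) ∷ []) ∷ [])) (split 0 2 (split 0 8
  (exclusive 3 0 9 (common 6 0 (stuck 9 7 3 ∷ []) ∷ [])) (split 0 6 (common 8 0 (stuck 9 7 3 ∷ []))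
  (exclusive 0 9 8 (exclusive 0 7 9 [] ∷ [])))) (common 2 0 (exclusive 0 8 9 (exclusive 0 6 9 [] ∷ [])
  ∷ [])))))) (common 8 0 (common 8 4 [] ∷ []))) (exclusive 6 8 7 (common 9 0 (common 6 1 (common 7 1
  (split 0 8 (stuck 9 7 3) (common 8 0 (stuck 9 8 7 ∷ [])) ∷ []) ∷ []) ∷ []) ∷ [])))) (common 8 2
  (common 6 2 [] ∷ []))) (common 8 2 (common 8 4 (split 2 4 (common 8 2 (split 1 7 (split 0 7 (stuck 9
  6 1) (common 7 0 (stuck 9 8 7 ∷ []))) (common 7 1 (stuck 9 8 7 ∷ [])) ∷ [])) (common 9 2 (common 7 3
  [] ∷ [])) ∷ []) ∷ []))) (exclusive 5 7 8 (common 8 0 (common 7 3 (split 1 4 (common 6 4 (common 7 4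
  (split 2 9 (split 0 9 (stuck 8 7 0) (common 9 0 (stuck 9 8 6 ∷ []))) (common 9 2 (stuck 9 8 7 ∷ []))
  ∷ []) ∷ [])) (common 8 4 (common 7 4 (split 2 9 (split 1 9 (stuck 8 6 2) (common 9 1 (stuck 9 8 7 ∷
  []))) (common 9 2 (stuck 9 8 7 ∷ [])) ∷ []) ∷ [])) ∷ []) ∷ []) ∷ []))) ∷ [])) (split 0 4 (exclusive
  5 4 7 (split 3 5 (split 1 8 (exclusive 5 8 7 (exclusive 9 6 8 (common 7 4 [] ∷ []) ∷ [])) (common 8
  1 (common 7 4 (split 3 4 (common 7 3 (split 1 8 (split 0 8 (stuck 9 6 1) (common 8 0 (stuck 9 8 7 ∷
  []))) (common 8 1 (stuck 9 8 7 ∷ [])) ∷ [])) (common 9 3 (common 8 2 [] ∷ [])) ∷ []) ∷ [])))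
  (exclusive 5 6 8 (common 8 2 (common 7 0 (split 2 9 (exclusive 7 9 8 (common 7 4 (common 6 4 [] ∷
  []) ∷ [])) (common 9 2 (split 1 9 (common 9 3 (common 8 4 (stuck 9 8 7 ∷ []) ∷ [])) (common 9 3
  (common 8 4 (stuck 9 8 7 ∷ []) ∷ [])) ∷ [])) ∷ []) ∷ []) ∷ [])) ∷ [])) (exclusive 4 7 6 (split 3 5
  (split 1 8 (common 6 3 (common 9 1 (split 3 4 (common 7 3 (split 1 8 (split 0 8 (stuck 9 7 1)
  (common 8 0 (stuck 9 8 7 ∷ []))) (common 8 1 (stuck 9 8 6 ∷ [])) ∷ [])) (common 9 3 (common 6 3 [] ∷
  [])) ∷ []) ∷ [])) (exclusive 8 5 7 (common 9 1 (common 8 4 (common 7 4 (split 1 8 (common 8 2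
  (common 7 3 (stuck 9 8 7 ∷ []) ∷ [])) (common 8 2 (common 7 3 (stuck 9 8 7 ∷ []) ∷ [])) ∷ []) ∷ [])
  ∷ []) ∷ []))) (split 0 7 (exclusive 5 7 8 (common 8 0 (split 3 4 (common 6 4 (split 2 4 (common 8 2
  []) (common 7 4 (common 8 2 (common 6 2 [] ∷ []) ∷ [])) ∷ [])) (common 8 4 (split 2 9 (common 4 3
  (common 9 3 (common 6 2 (exclusive 7 9 8 (stuck 9 8 7 ∷ []) ∷ []) ∷ []) ∷ [])) (common 9 3 (common 4
  3 (common 6 2 [] ∷ []) ∷ [])) ∷ [])) ∷ []) ∷ [])) (split 2 3 (split 0 3 (common 7 0 (common 6 3 [] ∷
  [])) (common 5 3 (common 9 1 (common 8 1 (common 7 3 [] ∷ []) ∷ []) ∷ []))) (common 7 3 (common 9 3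
  (common 6 3 (common 9 1 (common 6 2 (exclusive 7 9 8 (stuck 9 8 7 ∷ []) ∷ []) ∷ []) ∷ []) ∷ []) ∷
  [])))) ∷ [])))) ∷ [])) ∷ []) ∷ [])


noSix : {G : Graph 6} → ¬ ObstructionFree G
noSix free = contradictory free plan6₄ plan6₃ plan₀ _ _ _ zero

noSeven : {G : Graph 7} → ¬ ObstructionFree G
noSeven free = contradictory free plan7₄ plan7₃ plan₀ _ _ _ zero

noNine : {G : Graph 9} → ¬ ObstructionFree G
noNine free = contradictory free plan9₄ plan9₃ plan₀ _ _ _ zero

noTen : {G : Graph 10} → ¬ ObstructionFree G
noTen free = contradictory free plan10₄ plan10₃ plan₀ _ _ _ zero

-- Blow-ups and the removal of a level

Close : {V : Set} → Rel V 0ℓ → V → V → Set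
Close _~_ x y = x ≡ y ⊎ x ~ y ⊎ ∃[ w ] (x ~ w × y ~ w)

-- Both properties survive injections that preserve and reflect adjacency, so they are transported
-- together.
Linked : {V : Set} → Rel V 0ℓ → V → V → V → Set
Linked _~_ x y z = InducedPaths.Covered _~_ x y z × Close _~_ x y

Linked-map⁺ : {V W : Set} {_~_ : Rel V 0ℓ} {_≈_ : Rel W 0ℓ} (g : V → W) → Injective _≡_ _≡_ g →
  (∀ {x y} → x ~ y → g x ≈ g y) → (∀ {x y} → g x ≈ g y → x ~ y) →
  ∀ {x y z} → Linked _~_ x y z → Linked _≈_ (g x) (g y) (g z)
Linked-map⁺ g inj pres refl′ (covered , close) =
  Covered-map⁺ g inj pres refl′ covered ,
  Sum.map (cong g) (Sum.map pres λ (w , xw , yw) → g w , pres xw , pres yw) close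

-- The blow-up of a base graph with vertices 0, …, f + 2: the vertices f, f + 1
-- and f + 2 are replaced by k copies each, and the copies of f + c on level i
-- and of f + d on level j > i are adjacent if and only if d = c + 1 modulo 3.

Template : Set
Template = List (ℕ × ℕ)

Vertex : ℕ → ℕ → Set
Vertex f k = Fin f ⊎ (Fin k × Fin 3)

follows : Fin 3 → Fin 3 → Bool
follows zero             (suc zero)       = true
follows (suc zero)       (suc (suc zero)) = true
follows (suc (suc zero)) zero             = true
follows _                _                = false

edge : Template → ℕ → ℕ → Bool
edge es a b = any (λ (c , d) → (a ≡ᵇ c) ∧ (b ≡ᵇ d)) es

arc : Template → Vertex f k → Vertex f k → Bool
arc     es (inj₁ u)       (inj₁ v)       = edge es (toℕ u) (toℕ v)
arc {f} es (inj₁ u)       (inj₂ (j , d)) = edge es (toℕ u) (f + toℕ d)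
arc {f} es (inj₂ (i , c)) (inj₁ v)       = edge es (f + toℕ c) (toℕ v)
arc {f} es (inj₂ (i , c)) (inj₂ (j , d)) =
  ((toℕ i <ᵇ toℕ j) ∧ follows c d) ∨ ((toℕ i ≡ᵇ toℕ j) ∧ edge es (f + toℕ c) (f + toℕ d))

joined : Template → Vertex f k → Vertex f k → Bool
joined es u v = arc es u v ∨ arc es v u

lift : Fin (suc k) → Vertex f k → Vertex f (suc k)
lift l = Sum.map₂ (Product.map₁ (punchIn l))

punchIn-<ᵇ : ∀ (l : Fin (suc k)) i j → (toℕ (punchIn l i) <ᵇ toℕ (punchIn l j)) ≡ (toℕ i <ᵇ toℕ j)
punchIn-<ᵇ zero    i       j       = refl
punchIn-<ᵇ (suc l) zero    zero    = refl
punchIn-<ᵇ (suc l) zero    (suc j) = refl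
punchIn-<ᵇ (suc l) (suc i) zero    = refl
punchIn-<ᵇ (suc l) (suc i) (suc j) = punchIn-<ᵇ l i j

punchIn-≡ᵇ : ∀ (l : Fin (suc k)) i j → (toℕ (punchIn l i) ≡ᵇ toℕ (punchIn l j)) ≡ (toℕ i ≡ᵇ toℕ j)
punchIn-≡ᵇ zero    i       j       = refl
punchIn-≡ᵇ (suc l) zero    zero    = refl
punchIn-≡ᵇ (suc l) zero    (suc j) = refl
punchIn-≡ᵇ (suc l) (suc i) zero    = refl
punchIn-≡ᵇ (suc l) (suc i) (suc j) = punchIn-≡ᵇ l i j

-- Adjacency depends on levels only through their order and equality, and `punchIn` respects both.
arc-lift : ∀ es l (u v : Vertex f k) → arc es (lift l u) (lift l v) ≡ arc es u v
arc-lift es l (inj₁ _)       (inj₁ _)       = refl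
arc-lift es l (inj₁ _)       (inj₂ _)       = refl
arc-lift es l (inj₂ _)       (inj₁ _)       = refl
arc-lift es l (inj₂ (i , c)) (inj₂ (j , d)) rewrite punchIn-<ᵇ l i j | punchIn-≡ᵇ l i j = refl

joined-lift : ∀ es l (u v : Vertex f k) → joined es (lift l u) (lift l v) ≡ joined es u v
joined-lift es l u v = cong₂ _∨_ (arc-lift es l u v) (arc-lift es l v u)

lift-injective : ∀ (l : Fin (suc k)) → Injective _≡_ _≡_ (lift {f = f} l)
lift-injective l {inj₁ _} {inj₁ _} refl = refl
lift-injective l {inj₂ (i , c)} {inj₂ (j , d)} eq
  with eqᵢ , refl ← ,-injective (inj₂-injective eq) with refl ← Fin.punchIn-injective l i j eqᵢ = refl

OnLevel : Fin k → Vertex f k → Set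
OnLevel l (inj₁ _)       = ⊥
OnLevel l (inj₂ (i , _)) = i ≡ l

unlift : ∀ (l : Fin (suc k)) (u : Vertex f (suc k)) → ¬ OnLevel l u → ∃[ u′ ] lift l u′ ≡ u
unlift l (inj₁ u)       _   = inj₁ u , refl
unlift l (inj₂ (i , c)) i≢l =
  inj₂ (punchOut (≢-sym i≢l) , c) , cong (λ j → inj₂ (j , c)) (punchIn-punchOut (≢-sym i≢l))

-- Vertices outside the levels are assigned level 0 by default. At worst this blocks level 0, and
-- three values still leave one of four or more levels free.
level : Vertex f (suc k) → Fin (suc k)
level (inj₁ _)       = zero
level (inj₂ (i , _)) = i

AllLinked : Template → ℕ → ℕ → Set
AllLinked es f k = ∀ (x y z : Vertex f k) → Linked (λ u v → T (joined es u v)) x y z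

level≢⇒off : ∀ {l} (u : Vertex f (suc k)) → level u ≢ l → ¬ OnLevel l u
level≢⇒off (inj₁ _) _   = λ ()
level≢⇒off (inj₂ _) i≢l = i≢l

allLinked-suc : ∀ {es} → 3 ≤ k → AllLinked es f k → AllLinked es f (suc k)
allLinked-suc {k} {f} {es} 3≤k linked x y z
  with l , unused ← missed {3} {suc k} (s≤s 3≤k)
    (λ { zero → level x ; (suc zero) → level y ; (suc (suc zero)) → level z })
  with x′ , refl ← unlift l x (level≢⇒off x (unused zero))
  with y′ , refl ← unlift l y (level≢⇒off y (unused (suc zero)))
  with z′ , refl ← unlift l z (level≢⇒off z (unused (suc (suc zero))))
  = Linked-map⁺ (lift l) (lift-injective l)
      (λ {u} {v} → subst T (sym (joined-lift es l u v))) (λ {u} {v} → subst T (joined-lift es l u v))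
      (linked x′ y′ z′)

joined-sym : ∀ es (u v : Vertex f k) → T (joined es u v) → T (joined es v u)
joined-sym es u v = subst T (∨-comm (arc es u v) (arc es v u))

Loopless : Template → Set
Loopless es = ∀ a → ¬ T (edge es a a)

loopless : ∀ es → T (all (λ (c , d) → not (c ≡ᵇ d)) es) → Loopless es
loopless es check a loop
  with (c , d) , ∈es , both ← find (Any.any⁻ _ es loop)
  with a≡c , a≡d ← Equivalence.to T-∧ both =
  T-not⁻ (All.lookup (All.all⁺ _ es check) ∈es)
    (ℕ.≡⇒≡ᵇ c d (trans (sym (ℕ.≡ᵇ⇒≡ a c a≡c)) (ℕ.≡ᵇ⇒≡ a d a≡d)))

arc-irrefl : ∀ {es} → Loopless es → (u : Vertex f k) → ¬ T (arc es u u)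
arc-irrefl     noLoops (inj₁ u) = noLoops (toℕ u)
arc-irrefl {f} noLoops (inj₂ (i , c)) loop with Equivalence.to T-∨ loop
... | inj₁ i<i = ℕ.n≮n (toℕ i) (ℕ.<ᵇ⇒< _ _ (proj₁ (Equivalence.to T-∧ i<i)))
... | inj₂ i≡i = noLoops (f + toℕ c) (proj₂ (Equivalence.to (T-∧ {toℕ i ≡ᵇ toℕ i}) i≡i))

-- In this numbering, which the lists of paths below follow, the copy of type c on level i is f + 3i
-- + c.
Vertex↔Fin : Fin (f + k * 3) ↔ Vertex f k
Vertex↔Fin = (↔-id _ ⊎-↔ *↔×) ↔-∘ +↔⊎

decode : ∀ f k → Fin (f + k * 3) → Vertex f k
decode f k = Inverse.to (Vertex↔Fin {f} {k})

joinedᶠ : Template → ∀ f k → Fin (f + k * 3) → Fin (f + k * 3) → Bool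
joinedᶠ es f k u v = joined es (decode f k u) (decode f k v)

blowUp : ∀ es f k → Loopless es → Graph (f + k * 3)
blowUp es f k noLoops = record
  { Adj    = λ u v → T (joinedᶠ es f k u v)
  ; adj?   = λ u v → T? _
  ; sym    = λ {u} {v} → joined-sym es (decode f k u) (decode f k v)
  ; irrefl = λ { {u} refl loop →
      [ arc-irrefl noLoops (decode f k u) , arc-irrefl noLoops (decode f k u) ]′ (Equivalence.to T-∨ loop) }
  }

-- Verification of lists of induced paths

module _ {m} (_~ᵇ_ : Fin m → Fin m → Bool) where

  open InducedPaths (λ i j → T (i ~ᵇ j))

  inducedᵇ : List (Fin m) → Bool
  inducedᵇ []          = false
  inducedᵇ (x ∷ [])    = true
  inducedᵇ (x ∷ y ∷ p) = ((x ~ᵇ y) ∧ all (λ z → not (x == z) ∧ not (x ~ᵇ z)) p) ∧ inducedᵇ (y ∷ p)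

  inducedᵇ-sound : ∀ p → T (inducedᵇ p) → Induced p
  inducedᵇ-sound (x ∷ [])    _     = [-]
  inducedᵇ-sound (x ∷ y ∷ p) check =
    let first , rest = Equivalence.to T-∧ check
        x~y , away   = Equivalence.to T-∧ first
    in (x~y , All.map separate (All.all⁺ _ p away)) ∷ inducedᵇ-sound (y ∷ p) rest
    where
    separate : ∀ {z} → T (not (x == z) ∧ not (x ~ᵇ z)) → x ≢ z × ¬ T (x ~ᵇ z)
    separate both = let x≠z , x≁z = Equivalence.to T-∧ both in T-not⁻ x≠z ∘ ≡⇒== _ _ , T-not⁻ x≁z

  through : Fin m → List (List (Fin m)) → List (List (Fin m))
  through i = filterᵇ (i ∈ᵇ_)

  everywhere : (Fin m → Bool) → Bool
  everywhere p = all p (allFin m)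

  everywhere-sound : ∀ {p} → T (everywhere p) → ∀ i → T (p i)
  everywhere-sound check i = All.lookup (All.all⁺ _ (allFin m) check) (∈-allFin i)

  -- Separate functions, so that each selection of paths is evaluated only once.
  covered₁ covered₂ covered₃ : List (List (Fin m)) → Bool
  covered₁ ps = everywhere λ i → any (i ∈ᵇ_) ps
  covered₂ ps = everywhere λ i → covered₁ (through i ps)
  covered₃ ps = everywhere λ i → covered₂ (through i ps)

  closeᵇ : Bool
  closeᵇ = everywhere λ i → everywhere λ j →
    (i == j) ∨ (i ~ᵇ j) ∨ any (λ k → (i ~ᵇ k) ∧ (j ~ᵇ k)) (allFin m)

  closeᵇ-sound : T closeᵇ → ∀ i j → Close (λ i j → T (i ~ᵇ j)) i j
  closeᵇ-sound check i j with Equivalence.to T-∨ (everywhere-sound (everywhere-sound check i) j)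
  ... | inj₁ eq = inj₁ (==⇒≡ i j eq)
  ... | inj₂ rest with Equivalence.to T-∨ rest
  ...   | inj₁ adj = inj₂ (inj₁ adj)
  ...   | inj₂ com with k , _ , both ← find (Any.any⁻ _ (allFin m) com) =
    inj₂ (inj₂ (k , Equivalence.to T-∧ both))

  linkedᵇ : List (List (Fin m)) → Bool
  linkedᵇ ps = (all inducedᵇ ps ∧ covered₃ ps) ∧ closeᵇ

  linkedᵇ-sound : ∀ ps → T (linkedᵇ ps) → ∀ x y z → Linked (λ i j → T (i ~ᵇ j)) x y z
  linkedᵇ-sound ps check x y z with paths-ok , close ← Equivalence.to T-∧ check
    with induced , covered ← Equivalence.to T-∧ paths-ok
    with p , p∈ , z∈p ← find (Any.any⁻ _ _
      (everywhere-sound (everywhere-sound (everywhere-sound covered x) y) z))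
    with p∈′ , y∈p ← ∈-filter⁻ (T? ∘ (y ∈ᵇ_)) p∈
    with p∈ps , x∈p ← ∈-filter⁻ (T? ∘ (x ∈ᵇ_)) {xs = ps} p∈′
    = (p , inducedᵇ-sound p (All.lookup (All.all⁺ _ ps induced) p∈ps) ,
       ∈ᵇ⇒∈ p x∈p , ∈ᵇ⇒∈ p y∈p , ∈ᵇ⇒∈ p z∈p) ,
      closeᵇ-sound close x y

-- From linked triples to position number 2 and diameter 2

Realisable : ℕ → Set₁
Realisable n = Σ[ G ∈ Graph n ] (HasMonophonicPositionNumber G 2 × HasDiameter G 2)

module _ (G : Graph n) where

  open Graph G using (Adj; adj?; irrefl) renaming (sym to Adj-sym)

  linked⇒realisable : 3 ≤ n → (∀ x y z → Linked Adj x y z) → Realisable n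
  linked⇒realisable (s≤s (s≤s (s≤s z≤n))) linked =
    G , MonophonicPosition.covered⇒number≡2 G (s≤s (s≤s z≤n)) (λ x y z → proj₁ (linked x y z)) ,
    (λ u v → distance u v (proj₂ (linked u v v))) , far
    where
    apart⇒distance≡2 : ∀ {u v} → u ≢ v → ¬ Adj u v → Close Adj u v → IsDistance G u v 2
    apart⇒distance≡2 u≢v u≁v (inj₁ u≡v)                 = contradiction u≡v u≢v
    apart⇒distance≡2 u≢v u≁v (inj₂ (inj₁ uv))           = contradiction uv u≁v
    apart⇒distance≡2 u≢v u≁v (inj₂ (inj₂ (w , uw , vw))) = uw ∷ Adj-sym vw ∷ [] , λ
      { 0 _ []         → u≢v refl
      ; 1 _ (uv ∷ [])  → u≁v uv
      ; (suc (suc _)) (s≤s (s≤s ())) _ }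

    distance : ∀ u v → Close Adj u v → ∃[ e ] (IsDistance G u v e × e ≤ 2)
    distance u v close with u Fin.≟ v | adj? u v
    ... | yes refl | _       = 0 , ([] , λ _ ()) , z≤n
    ... | no u≢v   | yes uv  = 1 , (uv ∷ [] , λ { 0 _ [] → u≢v refl ; (suc _) (s≤s ()) _ }) , s≤s z≤n
    ... | no u≢v   | no u≁v  = 2 , apart⇒distance≡2 u≢v u≁v close , s≤s (s≤s z≤n)

    -- The vertices 0, 1 and 2 lie on an induced path, so they form no triangle, and two of them are
    -- nonadjacent.
    far : ∃[ u ] ∃[ v ] IsDistance G u v 2
    far with adj? zero (suc zero) | adj? (suc zero) (suc (suc zero)) | adj? (suc (suc zero)) zero
    ... | no ¬01 | _      | _      = _ , _ , apart⇒distance≡2 (λ ()) ¬01 (proj₂ (linked _ _ zero))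
    ... | _      | no ¬12 | _      = _ , _ , apart⇒distance≡2 (λ ()) ¬12 (proj₂ (linked _ _ zero))
    ... | _      | _      | no ¬20 = _ , _ , apart⇒distance≡2 (λ ()) ¬20 (proj₂ (linked _ _ zero))
    ... | yes 01~ | yes 12~ | yes 20~ = contradiction (proj₁ (linked _ _ _))
      (InducedPathProperties.triangle-uncovered irrefl Adj-sym 01~ 12~ 20~)

module Blowup (es : Template) (f k : ℕ) where

  to = decode f k
  from = Inverse.from (Vertex↔Fin {f} {k})

  to-from : ∀ v → to (from v) ≡ v
  to-from = Inverse.strictlyInverseˡ (Vertex↔Fin {f} {k})

  from-to : ∀ v → from (to v) ≡ v
  from-to = Inverse.strictlyInverseʳ (Vertex↔Fin {f} {k})

  decode-linked : (∀ x y z → Linked (λ u v → T (joinedᶠ es f k u v)) x y z) → AllLinked es f k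
  decode-linked linked x y z =
    subst (Linked _ x y) (to-from z) (subst₂ (λ x y → Linked _ x y _) (to-from x) (to-from y)
      (Linked-map⁺ to (λ {u} {v} eq → trans (sym (from-to u)) (trans (cong from eq) (from-to v))) id id
        (linked (from x) (from y) (from z))))

  encode-linked : AllLinked es f k → ∀ x y z → Linked (λ u v → T (joinedᶠ es f k u v)) x y z
  encode-linked linked x y z =
    subst (Linked _ x y) (from-to z) (subst₂ (λ x y → Linked _ x y _) (from-to x) (from-to y)
      (Linked-map⁺ from (λ {u} {v} eq → trans (sym (to-from u)) (trans (cong to eq) (to-from v)))
        (λ {u} {v} → subst₂ (λ u v → T (joined es u v)) (sym (to-from u)) (sym (to-from v)))
        (λ {u} {v} → subst₂ (λ u v → T (joined es u v)) (to-from u) (to-from v))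
        (linked (to x) (to y) (to z))))

-- Templates and their covering lists of induced paths

path₃ : Template
path₃ = (0 , 1) ∷ (1 , 2) ∷ []

-- These lists are certificates, named after the order of the graph: every path is induced, and any
-- three vertices occur together on one of them.
paths3 : List (List ℕ)
paths3 =
  (0 ∷ 1 ∷ 2 ∷ []) ∷ []

cycle₄ : Template
cycle₄ = (0 , 1) ∷ (0 , 3) ∷ (1 , 2) ∷ (2 , 3) ∷ []

paths4 : List (List ℕ)
paths4 =
  (0 ∷ 1 ∷ 2 ∷ []) ∷ (0 ∷ 3 ∷ 2 ∷ []) ∷ (1 ∷ 0 ∷ 3 ∷ []) ∷ (1 ∷ 2 ∷ 3 ∷ []) ∷ []

-- The 5-cycle 0, 1, 4, 3, 2, in which 2, 3 and 4 are blown up. Two levels give the Wagner graph, of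
-- order 8.
family₂ : Template
family₂ = (0 , 1) ∷ (0 , 2) ∷ (1 , 4) ∷ (2 , 3) ∷ (3 , 4) ∷ []

paths5 : List (List ℕ)
paths5 =
  (0 ∷ 1 ∷ 4 ∷ 3 ∷ []) ∷ (0 ∷ 2 ∷ 3 ∷ 4 ∷ []) ∷ (1 ∷ 0 ∷ 2 ∷ 3 ∷ []) ∷ (1 ∷ 4 ∷ 3 ∷ 2 ∷ []) ∷ []

paths8 : List (List ℕ)
paths8 =
  (0 ∷ 5 ∷ 4 ∷ 3 ∷ 7 ∷ []) ∷ (1 ∷ 4 ∷ 3 ∷ 2 ∷ 6 ∷ []) ∷ (0 ∷ 5 ∷ 6 ∷ 7 ∷ 3 ∷ []) ∷
  (3 ∷ 7 ∷ 1 ∷ 0 ∷ 5 ∷ []) ∷ (5 ∷ 0 ∷ 2 ∷ 3 ∷ 7 ∷ []) ∷ (1 ∷ 4 ∷ 5 ∷ 6 ∷ 2 ∷ []) ∷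
  (2 ∷ 6 ∷ 7 ∷ 1 ∷ 4 ∷ []) ∷ (4 ∷ 1 ∷ 0 ∷ 2 ∷ 6 ∷ []) ∷ []

paths11 : List (List ℕ)
paths11 =
  (0 ∷ 5 ∷ 9 ∷ 10 ∷ 3 ∷ 7 ∷ []) ∷ (1 ∷ 4 ∷ 8 ∷ 9 ∷ 2 ∷ 6 ∷ []) ∷ (0 ∷ 8 ∷ 4 ∷ 3 ∷ 10 ∷ 6 ∷ []) ∷
  (1 ∷ 7 ∷ 3 ∷ 2 ∷ 9 ∷ 5 ∷ []) ∷ (2 ∷ 6 ∷ 5 ∷ 4 ∷ 8 ∷ []) ∷ (2 ∷ 6 ∷ 7 ∷ 8 ∷ 4 ∷ []) ∷
  (2 ∷ 6 ∷ 10 ∷ 1 ∷ 4 ∷ 8 ∷ []) ∷ (4 ∷ 1 ∷ 0 ∷ 2 ∷ 9 ∷ []) ∷ (5 ∷ 0 ∷ 8 ∷ 7 ∷ 3 ∷ 10 ∷ []) ∷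
  (3 ∷ 7 ∷ 6 ∷ 5 ∷ 9 ∷ []) ∷ (7 ∷ 3 ∷ 4 ∷ 5 ∷ 9 ∷ []) ∷ (3 ∷ 10 ∷ 1 ∷ 0 ∷ 5 ∷ []) ∷
  (5 ∷ 0 ∷ 2 ∷ 3 ∷ 10 ∷ []) ∷ (0 ∷ 1 ∷ 7 ∷ 6 ∷ []) ∷ (0 ∷ 8 ∷ 9 ∷ 10 ∷ 6 ∷ []) ∷
  (1 ∷ 4 ∷ 3 ∷ 2 ∷ 6 ∷ []) ∷ (1 ∷ 7 ∷ 8 ∷ 9 ∷ 5 ∷ []) ∷ (2 ∷ 9 ∷ 10 ∷ 1 ∷ 7 ∷ []) ∷
  (0 ∷ 2 ∷ 6 ∷ 7 ∷ []) ∷ (0 ∷ 5 ∷ 4 ∷ 3 ∷ 7 ∷ []) ∷ (0 ∷ 5 ∷ 6 ∷ 10 ∷ 3 ∷ []) ∷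
  (1 ∷ 4 ∷ 5 ∷ 6 ∷ 2 ∷ []) ∷ (3 ∷ 2 ∷ 0 ∷ 8 ∷ []) ∷ (3 ∷ 10 ∷ 1 ∷ 0 ∷ 8 ∷ []) ∷
  (4 ∷ 5 ∷ 9 ∷ 10 ∷ []) ∷ (4 ∷ 8 ∷ 7 ∷ 6 ∷ 10 ∷ []) ∷ (0 ∷ 8 ∷ 9 ∷ 10 ∷ 3 ∷ []) ∷
  (2 ∷ 6 ∷ 7 ∷ 1 ∷ 4 ∷ []) ∷ []

-- A single level would give order 9, and order 10 for `family₇`; both are excluded, so certificates
-- exist only from two levels on.
family₆ : Template
family₆ = (0 , 2) ∷ (0 , 3) ∷ (0 , 6) ∷ (1 , 3) ∷ (1 , 5) ∷ (1 , 8) ∷ (2 , 4) ∷ (2 , 8) ∷ (3 , 7) ∷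
  (4 , 5) ∷ (4 , 7) ∷ (5 , 6) ∷ (6 , 8) ∷ (7 , 8) ∷ []

paths12 : List (List ℕ)
paths12 =
  (0 ∷ 6 ∷ 5 ∷ 1 ∷ 11 ∷ 7 ∷ []) ∷ (3 ∷ 10 ∷ 4 ∷ 2 ∷ 8 ∷ 9 ∷ []) ∷ (7 ∷ 3 ∷ 10 ∷ 6 ∷ 5 ∷ 9 ∷ []) ∷
  (0 ∷ 9 ∷ 8 ∷ 7 ∷ 4 ∷ 10 ∷ []) ∷ (3 ∷ 1 ∷ 11 ∷ 2 ∷ 4 ∷ []) ∷ (5 ∷ 6 ∷ 0 ∷ 2 ∷ 11 ∷ 7 ∷ []) ∷
  (1 ∷ 8 ∷ 6 ∷ 10 ∷ 4 ∷ []) ∷ (4 ∷ 7 ∷ 11 ∷ 9 ∷ 0 ∷ 6 ∷ []) ∷ (0 ∷ 3 ∷ 1 ∷ 5 ∷ 4 ∷ []) ∷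
  (0 ∷ 2 ∷ 8 ∷ 1 ∷ 5 ∷ []) ∷ (3 ∷ 10 ∷ 11 ∷ 9 ∷ 8 ∷ []) ∷ (1 ∷ 5 ∷ 9 ∷ 0 ∷ 2 ∷ []) ∷
  (1 ∷ 3 ∷ 7 ∷ 4 ∷ 2 ∷ []) ∷ (3 ∷ 7 ∷ 8 ∷ 6 ∷ 5 ∷ []) ∷ (4 ∷ 10 ∷ 3 ∷ 1 ∷ 8 ∷ 9 ∷ []) ∷
  (5 ∷ 6 ∷ 0 ∷ 3 ∷ 7 ∷ 11 ∷ []) ∷ (0 ∷ 6 ∷ 10 ∷ 11 ∷ 1 ∷ []) ∷ (3 ∷ 10 ∷ 4 ∷ 5 ∷ 9 ∷ 8 ∷ []) ∷
  (0 ∷ 6 ∷ 8 ∷ 1 ∷ 11 ∷ []) ∷ (2 ∷ 11 ∷ 10 ∷ 6 ∷ 5 ∷ []) ∷ (3 ∷ 0 ∷ 2 ∷ 4 ∷ 5 ∷ []) ∷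
  (0 ∷ 6 ∷ 5 ∷ 4 ∷ 7 ∷ 11 ∷ []) ∷ (2 ∷ 11 ∷ 9 ∷ 5 ∷ 6 ∷ []) ∷ (4 ∷ 10 ∷ 3 ∷ 0 ∷ 9 ∷ 8 ∷ []) ∷
  (5 ∷ 6 ∷ 8 ∷ 2 ∷ 11 ∷ []) ∷ (1 ∷ 8 ∷ 7 ∷ 4 ∷ 10 ∷ []) ∷ (1 ∷ 11 ∷ 9 ∷ 0 ∷ 6 ∷ []) ∷
  (2 ∷ 8 ∷ 7 ∷ 3 ∷ 10 ∷ []) ∷ (4 ∷ 10 ∷ 11 ∷ 1 ∷ 8 ∷ []) ∷ (8 ∷ 7 ∷ 11 ∷ 10 ∷ []) ∷
  (0 ∷ 2 ∷ 4 ∷ 10 ∷ []) ∷ (0 ∷ 3 ∷ 10 ∷ 4 ∷ 5 ∷ []) ∷ (1 ∷ 3 ∷ 0 ∷ 6 ∷ []) ∷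
  (1 ∷ 3 ∷ 10 ∷ 4 ∷ 2 ∷ []) ∷ (1 ∷ 5 ∷ 4 ∷ 10 ∷ []) ∷ (1 ∷ 5 ∷ 6 ∷ 0 ∷ 2 ∷ []) ∷
  (2 ∷ 4 ∷ 5 ∷ 6 ∷ []) ∷ (2 ∷ 8 ∷ 6 ∷ 10 ∷ 3 ∷ []) ∷ (3 ∷ 0 ∷ 6 ∷ 5 ∷ 4 ∷ []) ∷
  (3 ∷ 10 ∷ 6 ∷ 8 ∷ 9 ∷ []) ∷ (7 ∷ 3 ∷ 1 ∷ 5 ∷ 9 ∷ []) ∷ (7 ∷ 4 ∷ 2 ∷ 0 ∷ 9 ∷ []) ∷ []

paths15 : List (List ℕ)
paths15 =
  (0 ∷ 6 ∷ 13 ∷ 4 ∷ 7 ∷ 11 ∷ 1 ∷ []) ∷ (3 ∷ 10 ∷ 14 ∷ 2 ∷ 8 ∷ 9 ∷ 5 ∷ []) ∷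
  (2 ∷ 11 ∷ 12 ∷ 5 ∷ 6 ∷ 13 ∷ 3 ∷ []) ∷ (0 ∷ 9 ∷ 8 ∷ 1 ∷ 14 ∷ 10 ∷ 4 ∷ []) ∷
  (6 ∷ 5 ∷ 9 ∷ 11 ∷ 7 ∷ 14 ∷ []) ∷ (8 ∷ 12 ∷ 11 ∷ 10 ∷ 4 ∷ 13 ∷ []) ∷
  (4 ∷ 7 ∷ 14 ∷ 12 ∷ 0 ∷ 9 ∷ []) ∷ (5 ∷ 12 ∷ 8 ∷ 7 ∷ 3 ∷ 10 ∷ []) ∷ (0 ∷ 2 ∷ 4 ∷ 5 ∷ 1 ∷ []) ∷
  (4 ∷ 13 ∷ 3 ∷ 1 ∷ 8 ∷ 12 ∷ []) ∷ (5 ∷ 6 ∷ 0 ∷ 2 ∷ 14 ∷ 7 ∷ []) ∷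
  (7 ∷ 3 ∷ 13 ∷ 9 ∷ 5 ∷ 12 ∷ []) ∷ (7 ∷ 4 ∷ 10 ∷ 6 ∷ 0 ∷ 12 ∷ []) ∷ (0 ∷ 3 ∷ 10 ∷ 4 ∷ 5 ∷ []) ∷
  (0 ∷ 6 ∷ 13 ∷ 14 ∷ 1 ∷ 11 ∷ []) ∷ (3 ∷ 13 ∷ 6 ∷ 8 ∷ 2 ∷ 11 ∷ []) ∷ (1 ∷ 3 ∷ 7 ∷ 4 ∷ 2 ∷ []) ∷
  (0 ∷ 9 ∷ 5 ∷ 1 ∷ 14 ∷ 7 ∷ []) ∷ (0 ∷ 12 ∷ 8 ∷ 7 ∷ 4 ∷ 13 ∷ []) ∷
  (1 ∷ 11 ∷ 2 ∷ 4 ∷ 13 ∷ 6 ∷ []) ∷ (3 ∷ 7 ∷ 14 ∷ 12 ∷ 5 ∷ 6 ∷ []) ∷ (0 ∷ 9 ∷ 13 ∷ 14 ∷ 10 ∷ []) ∷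
  (1 ∷ 5 ∷ 12 ∷ 0 ∷ 2 ∷ []) ∷ (1 ∷ 11 ∷ 9 ∷ 13 ∷ 4 ∷ []) ∷ (1 ∷ 11 ∷ 10 ∷ 6 ∷ 13 ∷ []) ∷
  (2 ∷ 14 ∷ 10 ∷ 6 ∷ 5 ∷ 9 ∷ []) ∷ (3 ∷ 10 ∷ 4 ∷ 2 ∷ 8 ∷ 12 ∷ []) ∷
  (4 ∷ 13 ∷ 3 ∷ 0 ∷ 12 ∷ 11 ∷ []) ∷ (6 ∷ 0 ∷ 3 ∷ 1 ∷ 14 ∷ []) ∷ (8 ∷ 1 ∷ 5 ∷ 4 ∷ 13 ∷ []) ∷
  (0 ∷ 2 ∷ 11 ∷ 10 ∷ []) ∷ (0 ∷ 6 ∷ 5 ∷ 4 ∷ 7 ∷ 11 ∷ []) ∷ (0 ∷ 6 ∷ 8 ∷ 1 ∷ 11 ∷ []) ∷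
  (0 ∷ 9 ∷ 8 ∷ 7 ∷ 14 ∷ 10 ∷ []) ∷ (2 ∷ 8 ∷ 9 ∷ 13 ∷ 3 ∷ 10 ∷ []) ∷ (3 ∷ 10 ∷ 6 ∷ 8 ∷ 9 ∷ []) ∷
  (3 ∷ 10 ∷ 11 ∷ 9 ∷ 5 ∷ []) ∷ (3 ∷ 10 ∷ 14 ∷ 12 ∷ 8 ∷ 9 ∷ []) ∷ (3 ∷ 13 ∷ 14 ∷ 2 ∷ 11 ∷ []) ∷
  (4 ∷ 13 ∷ 14 ∷ 12 ∷ 11 ∷ []) ∷ (5 ∷ 6 ∷ 8 ∷ 7 ∷ 11 ∷ []) ∷ (8 ∷ 2 ∷ 0 ∷ 3 ∷ 13 ∷ []) ∷
  (9 ∷ 5 ∷ 1 ∷ 3 ∷ 10 ∷ []) ∷ (9 ∷ 5 ∷ 4 ∷ 2 ∷ 14 ∷ []) ∷ (1 ∷ 11 ∷ 9 ∷ 0 ∷ 6 ∷ []) ∷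
  (1 ∷ 14 ∷ 2 ∷ 0 ∷ 9 ∷ []) ∷ (2 ∷ 11 ∷ 7 ∷ 3 ∷ 13 ∷ 6 ∷ 5 ∷ []) ∷ (4 ∷ 7 ∷ 3 ∷ 0 ∷ 9 ∷ []) ∷
  (6 ∷ 13 ∷ 3 ∷ 1 ∷ 11 ∷ 12 ∷ []) ∷ (6 ∷ 13 ∷ 9 ∷ 11 ∷ 12 ∷ []) ∷ (8 ∷ 9 ∷ 11 ∷ 10 ∷ 14 ∷ []) ∷
  (0 ∷ 2 ∷ 8 ∷ 1 ∷ 5 ∷ []) ∷ (0 ∷ 6 ∷ 5 ∷ 1 ∷ 11 ∷ 7 ∷ []) ∷ (0 ∷ 12 ∷ 5 ∷ 4 ∷ 13 ∷ []) ∷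
  (1 ∷ 8 ∷ 7 ∷ 4 ∷ 10 ∷ []) ∷ (1 ∷ 14 ∷ 12 ∷ 0 ∷ 9 ∷ []) ∷ (2 ∷ 8 ∷ 7 ∷ 3 ∷ 10 ∷ []) ∷
  (2 ∷ 14 ∷ 12 ∷ 5 ∷ 9 ∷ []) ∷ (4 ∷ 10 ∷ 6 ∷ 8 ∷ 9 ∷ []) ∷ (5 ∷ 6 ∷ 13 ∷ 14 ∷ 7 ∷ 11 ∷ []) ∷
  (6 ∷ 8 ∷ 12 ∷ 14 ∷ []) ∷ (7 ∷ 11 ∷ 10 ∷ 6 ∷ 13 ∷ []) ∷ (0 ∷ 6 ∷ 5 ∷ 4 ∷ 7 ∷ 14 ∷ []) ∷
  (0 ∷ 12 ∷ 11 ∷ 7 ∷ 4 ∷ 13 ∷ []) ∷ (1 ∷ 3 ∷ 10 ∷ 4 ∷ 2 ∷ []) ∷ (2 ∷ 11 ∷ 9 ∷ 5 ∷ 6 ∷ []) ∷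
  (3 ∷ 0 ∷ 6 ∷ 5 ∷ 4 ∷ []) ∷ (3 ∷ 1 ∷ 14 ∷ 2 ∷ 4 ∷ []) ∷ (3 ∷ 13 ∷ 14 ∷ 2 ∷ 8 ∷ []) ∷
  (4 ∷ 10 ∷ 3 ∷ 1 ∷ 8 ∷ 12 ∷ []) ∷ (5 ∷ 9 ∷ 0 ∷ 2 ∷ 14 ∷ 7 ∷ []) ∷ (5 ∷ 9 ∷ 13 ∷ 3 ∷ 10 ∷ []) ∷
  (7 ∷ 3 ∷ 1 ∷ 5 ∷ 12 ∷ []) ∷ (7 ∷ 4 ∷ 2 ∷ 0 ∷ 12 ∷ []) ∷ []

family₇ : Template
family₇ = (0 , 1) ∷ (0 , 2) ∷ (0 , 9) ∷ (1 , 3) ∷ (1 , 5) ∷ (1 , 7) ∷ (2 , 4) ∷ (2 , 8) ∷ (3 , 6) ∷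
  (3 , 8) ∷ (4 , 5) ∷ (4 , 6) ∷ (4 , 7) ∷ (5 , 8) ∷ (6 , 9) ∷ (7 , 9) ∷ (8 , 9) ∷ []

paths13 : List (List ℕ)
paths13 =
  (0 ∷ 9 ∷ 10 ∷ 4 ∷ 5 ∷ 11 ∷ 3 ∷ []) ∷ (2 ∷ 11 ∷ 5 ∷ 1 ∷ 10 ∷ 9 ∷ 6 ∷ []) ∷
  (1 ∷ 7 ∷ 4 ∷ 2 ∷ 8 ∷ 12 ∷ []) ∷ (0 ∷ 12 ∷ 8 ∷ 5 ∷ 4 ∷ 7 ∷ []) ∷ (3 ∷ 8 ∷ 12 ∷ 10 ∷ 4 ∷ 7 ∷ []) ∷
  (5 ∷ 1 ∷ 7 ∷ 9 ∷ 6 ∷ 12 ∷ []) ∷ (0 ∷ 2 ∷ 8 ∷ 3 ∷ 6 ∷ []) ∷ (8 ∷ 2 ∷ 11 ∷ 7 ∷ 1 ∷ 10 ∷ []) ∷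
  (0 ∷ 1 ∷ 3 ∷ 6 ∷ 4 ∷ []) ∷ (1 ∷ 5 ∷ 8 ∷ 9 ∷ 6 ∷ []) ∷ (2 ∷ 11 ∷ 3 ∷ 1 ∷ 10 ∷ 9 ∷ []) ∷
  (2 ∷ 11 ∷ 12 ∷ 10 ∷ 9 ∷ []) ∷ (0 ∷ 9 ∷ 6 ∷ 3 ∷ 11 ∷ 5 ∷ []) ∷ (0 ∷ 9 ∷ 7 ∷ 11 ∷ 3 ∷ []) ∷
  (2 ∷ 0 ∷ 12 ∷ 6 ∷ 3 ∷ []) ∷ (4 ∷ 10 ∷ 9 ∷ 8 ∷ 3 ∷ 11 ∷ []) ∷ (1 ∷ 7 ∷ 4 ∷ 6 ∷ 12 ∷ 8 ∷ []) ∷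
  (2 ∷ 4 ∷ 5 ∷ 1 ∷ 3 ∷ []) ∷ (4 ∷ 5 ∷ 11 ∷ 12 ∷ 0 ∷ 9 ∷ []) ∷ (8 ∷ 2 ∷ 0 ∷ 1 ∷ 10 ∷ []) ∷
  (9 ∷ 6 ∷ 4 ∷ 2 ∷ 11 ∷ []) ∷ (1 ∷ 7 ∷ 11 ∷ 12 ∷ 6 ∷ []) ∷ (0 ∷ 1 ∷ 10 ∷ 4 ∷ 6 ∷ []) ∷
  (0 ∷ 9 ∷ 8 ∷ 5 ∷ 11 ∷ []) ∷ (1 ∷ 7 ∷ 9 ∷ 8 ∷ 2 ∷ []) ∷ (2 ∷ 8 ∷ 3 ∷ 1 ∷ 7 ∷ []) ∷
  (4 ∷ 5 ∷ 1 ∷ 0 ∷ 9 ∷ []) ∷ (5 ∷ 1 ∷ 10 ∷ 12 ∷ 6 ∷ []) ∷ (5 ∷ 4 ∷ 2 ∷ 0 ∷ 9 ∷ []) ∷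
  (5 ∷ 11 ∷ 7 ∷ 9 ∷ 10 ∷ []) ∷ (6 ∷ 12 ∷ 0 ∷ 1 ∷ 7 ∷ []) ∷ (0 ∷ 2 ∷ 11 ∷ 7 ∷ []) ∷
  (0 ∷ 12 ∷ 10 ∷ 4 ∷ 7 ∷ []) ∷ (1 ∷ 3 ∷ 11 ∷ 12 ∷ []) ∷ (1 ∷ 10 ∷ 4 ∷ 2 ∷ 11 ∷ []) ∷
  (2 ∷ 8 ∷ 5 ∷ 1 ∷ 7 ∷ []) ∷ (3 ∷ 8 ∷ 5 ∷ 4 ∷ 7 ∷ []) ∷ (4 ∷ 7 ∷ 9 ∷ 8 ∷ 12 ∷ []) ∷
  (4 ∷ 7 ∷ 11 ∷ 12 ∷ 8 ∷ []) ∷ (8 ∷ 3 ∷ 6 ∷ 4 ∷ 10 ∷ []) ∷ (0 ∷ 1 ∷ 3 ∷ 11 ∷ []) ∷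
  (0 ∷ 1 ∷ 5 ∷ 4 ∷ 6 ∷ []) ∷ (2 ∷ 8 ∷ 5 ∷ 1 ∷ 10 ∷ []) ∷ (2 ∷ 11 ∷ 7 ∷ 9 ∷ 6 ∷ []) ∷
  (3 ∷ 6 ∷ 4 ∷ 7 ∷ []) ∷ (3 ∷ 11 ∷ 12 ∷ 0 ∷ 9 ∷ []) ∷ (5 ∷ 1 ∷ 3 ∷ 6 ∷ 12 ∷ []) ∷
  (5 ∷ 4 ∷ 2 ∷ 0 ∷ 12 ∷ []) ∷ (6 ∷ 9 ∷ 8 ∷ 2 ∷ 11 ∷ []) ∷ (6 ∷ 12 ∷ 10 ∷ 1 ∷ 7 ∷ []) ∷ []

paths16 : List (List ℕ)
paths16 =
  (0 ∷ 9 ∷ 10 ∷ 4 ∷ 5 ∷ 11 ∷ 3 ∷ []) ∷ (1 ∷ 7 ∷ 14 ∷ 2 ∷ 8 ∷ 12 ∷ 6 ∷ []) ∷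
  (0 ∷ 12 ∷ 13 ∷ 4 ∷ 7 ∷ 14 ∷ 3 ∷ []) ∷ (1 ∷ 10 ∷ 9 ∷ 6 ∷ 15 ∷ 11 ∷ 2 ∷ []) ∷
  (2 ∷ 14 ∷ 5 ∷ 1 ∷ 13 ∷ 9 ∷ 6 ∷ []) ∷ (0 ∷ 15 ∷ 8 ∷ 5 ∷ 4 ∷ 7 ∷ []) ∷
  (3 ∷ 8 ∷ 15 ∷ 13 ∷ 4 ∷ 10 ∷ []) ∷ (9 ∷ 13 ∷ 12 ∷ 11 ∷ 5 ∷ 14 ∷ []) ∷
  (5 ∷ 1 ∷ 10 ∷ 12 ∷ 6 ∷ 15 ∷ []) ∷ (8 ∷ 2 ∷ 11 ∷ 7 ∷ 1 ∷ 13 ∷ []) ∷ (0 ∷ 1 ∷ 3 ∷ 6 ∷ 4 ∷ []) ∷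
  (3 ∷ 11 ∷ 2 ∷ 0 ∷ 9 ∷ 13 ∷ []) ∷ (1 ∷ 7 ∷ 4 ∷ 2 ∷ 8 ∷ 15 ∷ []) ∷
  (4 ∷ 5 ∷ 14 ∷ 15 ∷ 0 ∷ 9 ∷ []) ∷ (0 ∷ 15 ∷ 11 ∷ 7 ∷ 4 ∷ 10 ∷ []) ∷
  (4 ∷ 13 ∷ 9 ∷ 8 ∷ 3 ∷ 14 ∷ []) ∷ (5 ∷ 1 ∷ 7 ∷ 9 ∷ 6 ∷ 12 ∷ []) ∷
  (11 ∷ 2 ∷ 14 ∷ 10 ∷ 1 ∷ 13 ∷ []) ∷ (0 ∷ 12 ∷ 6 ∷ 3 ∷ 14 ∷ 5 ∷ []) ∷
  (3 ∷ 8 ∷ 12 ∷ 10 ∷ 4 ∷ 7 ∷ []) ∷ (2 ∷ 14 ∷ 3 ∷ 1 ∷ 13 ∷ 12 ∷ []) ∷ (8 ∷ 2 ∷ 0 ∷ 1 ∷ 10 ∷ []) ∷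
  (2 ∷ 0 ∷ 15 ∷ 6 ∷ 3 ∷ []) ∷ (5 ∷ 4 ∷ 2 ∷ 0 ∷ 12 ∷ []) ∷ (6 ∷ 9 ∷ 0 ∷ 1 ∷ 5 ∷ 11 ∷ []) ∷
  (1 ∷ 7 ∷ 14 ∷ 15 ∷ 6 ∷ 12 ∷ []) ∷ (1 ∷ 10 ∷ 4 ∷ 6 ∷ 15 ∷ 8 ∷ []) ∷
  (1 ∷ 10 ∷ 9 ∷ 8 ∷ 15 ∷ 11 ∷ []) ∷ (5 ∷ 11 ∷ 15 ∷ 13 ∷ 9 ∷ 10 ∷ []) ∷
  (7 ∷ 14 ∷ 5 ∷ 8 ∷ 12 ∷ 13 ∷ []) ∷ (9 ∷ 0 ∷ 12 ∷ 11 ∷ 3 ∷ 14 ∷ []) ∷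
  (9 ∷ 10 ∷ 1 ∷ 3 ∷ 11 ∷ 15 ∷ []) ∷ (11 ∷ 3 ∷ 6 ∷ 4 ∷ 13 ∷ []) ∷ (2 ∷ 11 ∷ 12 ∷ 10 ∷ 9 ∷ []) ∷
  (2 ∷ 14 ∷ 15 ∷ 13 ∷ 12 ∷ []) ∷ (3 ∷ 11 ∷ 2 ∷ 4 ∷ 10 ∷ 9 ∷ []) ∷ (6 ∷ 9 ∷ 8 ∷ 5 ∷ 11 ∷ []) ∷
  (6 ∷ 12 ∷ 11 ∷ 7 ∷ 14 ∷ []) ∷ (8 ∷ 12 ∷ 0 ∷ 1 ∷ 7 ∷ 14 ∷ []) ∷ (0 ∷ 2 ∷ 8 ∷ 3 ∷ 6 ∷ []) ∷
  (0 ∷ 9 ∷ 7 ∷ 11 ∷ 3 ∷ []) ∷ (0 ∷ 12 ∷ 6 ∷ 4 ∷ 7 ∷ 14 ∷ []) ∷ (0 ∷ 12 ∷ 10 ∷ 14 ∷ 3 ∷ []) ∷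
  (1 ∷ 5 ∷ 4 ∷ 6 ∷ 9 ∷ []) ∷ (1 ∷ 13 ∷ 4 ∷ 2 ∷ 14 ∷ []) ∷ (2 ∷ 8 ∷ 5 ∷ 1 ∷ 10 ∷ []) ∷
  (4 ∷ 7 ∷ 9 ∷ 8 ∷ 12 ∷ []) ∷ (4 ∷ 10 ∷ 14 ∷ 15 ∷ 8 ∷ []) ∷ (6 ∷ 15 ∷ 13 ∷ 1 ∷ 7 ∷ []) ∷
  (0 ∷ 9 ∷ 8 ∷ 3 ∷ 11 ∷ []) ∷ (0 ∷ 9 ∷ 13 ∷ 4 ∷ 5 ∷ 11 ∷ 3 ∷ []) ∷ (2 ∷ 8 ∷ 3 ∷ 1 ∷ 7 ∷ []) ∷
  (2 ∷ 11 ∷ 7 ∷ 9 ∷ 10 ∷ []) ∷ (3 ∷ 14 ∷ 15 ∷ 0 ∷ 12 ∷ []) ∷ (4 ∷ 7 ∷ 11 ∷ 12 ∷ 8 ∷ []) ∷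
  (5 ∷ 14 ∷ 10 ∷ 9 ∷ 6 ∷ []) ∷ (7 ∷ 14 ∷ 10 ∷ 12 ∷ 13 ∷ []) ∷ (0 ∷ 1 ∷ 13 ∷ 4 ∷ 6 ∷ []) ∷
  (0 ∷ 2 ∷ 14 ∷ 7 ∷ []) ∷ (0 ∷ 15 ∷ 13 ∷ 4 ∷ 10 ∷ []) ∷ (1 ∷ 10 ∷ 12 ∷ 11 ∷ 15 ∷ []) ∷
  (2 ∷ 4 ∷ 5 ∷ 1 ∷ 3 ∷ []) ∷ (2 ∷ 11 ∷ 3 ∷ 6 ∷ 9 ∷ 10 ∷ []) ∷ (2 ∷ 14 ∷ 7 ∷ 9 ∷ 13 ∷ 12 ∷ []) ∷
  (3 ∷ 8 ∷ 5 ∷ 4 ∷ 7 ∷ []) ∷ (4 ∷ 7 ∷ 14 ∷ 15 ∷ 8 ∷ 12 ∷ []) ∷ (4 ∷ 10 ∷ 1 ∷ 0 ∷ 15 ∷ 11 ∷ []) ∷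
  (4 ∷ 10 ∷ 14 ∷ 15 ∷ 11 ∷ []) ∷ (5 ∷ 11 ∷ 7 ∷ 9 ∷ 10 ∷ []) ∷ (6 ∷ 12 ∷ 10 ∷ 1 ∷ 7 ∷ []) ∷
  (7 ∷ 1 ∷ 3 ∷ 6 ∷ 15 ∷ []) ∷ (0 ∷ 1 ∷ 10 ∷ 4 ∷ 6 ∷ []) ∷ (0 ∷ 2 ∷ 4 ∷ 6 ∷ 3 ∷ []) ∷
  (0 ∷ 2 ∷ 11 ∷ 5 ∷ []) ∷ (1 ∷ 0 ∷ 12 ∷ 6 ∷ 4 ∷ []) ∷ (1 ∷ 7 ∷ 9 ∷ 6 ∷ 15 ∷ []) ∷
  (1 ∷ 7 ∷ 9 ∷ 8 ∷ 2 ∷ []) ∷ (1 ∷ 13 ∷ 12 ∷ 6 ∷ []) ∷ (2 ∷ 8 ∷ 5 ∷ 1 ∷ 7 ∷ []) ∷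
  (5 ∷ 1 ∷ 3 ∷ 6 ∷ 15 ∷ []) ∷ (5 ∷ 4 ∷ 2 ∷ 0 ∷ 15 ∷ []) ∷ (6 ∷ 15 ∷ 13 ∷ 1 ∷ 10 ∷ []) ∷
  (8 ∷ 2 ∷ 0 ∷ 1 ∷ 13 ∷ []) ∷ (8 ∷ 3 ∷ 6 ∷ 4 ∷ 13 ∷ []) ∷ (8 ∷ 12 ∷ 11 ∷ 7 ∷ 14 ∷ []) ∷
  (9 ∷ 10 ∷ 12 ∷ 11 ∷ 15 ∷ []) ∷ []


-- Realisation of all admissible orders

base : ∀ (es : Template) {f} k (ps : List (List ℕ)) →
       T (linkedᵇ (joinedᶠ es (suc f) k) (map (map #) ps)) → AllLinked es (suc f) k
base es {f} k ps check = Blowup.decode-linked es (suc f) k (linkedᵇ-sound _ (map (map #) ps) check)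

grow : ∀ {es f} → AllLinked es f 3 → ∀ k → AllLinked es f (3 + k)
grow linked zero    = linked
grow linked (suc k) = allLinked-suc (s≤s (s≤s (s≤s z≤n))) (grow linked k)

realise : ∀ es {f k} → T (all (λ (c , d) → not (c ≡ᵇ d)) es) →
          3 ≤ f + k * 3 → AllLinked es f k → Realisable (f + k * 3)
realise es {f} {k} noLoops 3≤ linked =
  linked⇒realisable (blowUp es f k (loopless es noLoops)) 3≤ (Blowup.encode-linked es f k linked)

3≤3+ : ∀ {n} → 3 ≤ 3 + n
3≤3+ = s≤s (s≤s (s≤s z≤n))

realisable-3 : Realisable 3
-- Without levels the template itself is the graph.
realisable-3 = realise path₃ {3} {0} _ 3≤3+ (base path₃ 0 paths3 _)

realisable-4 : Realisable 4
realisable-4 = realise cycle₄ {4} {0} _ 3≤3+ (base cycle₄ 0 paths4 _)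

realisable-5 : Realisable 5
realisable-5 = realise family₂ {2} {1} _ 3≤3+ (base family₂ 1 paths5 _)

realisable-8 : Realisable 8
realisable-8 = realise family₂ {2} {2} _ 3≤3+ (base family₂ 2 paths8 _)

realisable-11+ : ∀ k → Realisable (11 + k * 3)
realisable-11+ k = realise family₂ {2} {3 + k} _ 3≤3+ (grow (base family₂ 3 paths11 _) k)

realisable-12+ : ∀ k → Realisable (12 + k * 3)
-- Two levels lie below the start of the induction at three, so this order has a certificate of its
-- own.
realisable-12+ zero    = realise family₆ {6} {2} _ 3≤3+ (base family₆ 2 paths12 _)
realisable-12+ (suc k) = realise family₆ {6} {3 + k} _ 3≤3+ (grow (base family₆ 3 paths15 _) k)

realisable-13+ : ∀ k → Realisable (13 + k * 3)
realisable-13+ zero    = realise family₇ {7} {2} _ 3≤3+ (base family₇ 2 paths13 _)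
realisable-13+ (suc k) = realise family₇ {7} {3 + k} _ 3≤3+ (grow (base family₇ 3 paths16 _) k)

residue : ∀ m → ∃[ k ] (m ≡ k * 3 ⊎ m ≡ 1 + k * 3 ⊎ m ≡ 2 + k * 3)
residue 0 = 0 , inj₁ refl
residue 1 = 0 , inj₂ (inj₁ refl)
residue 2 = 0 , inj₂ (inj₂ refl)
residue (suc (suc (suc m))) =
  Product.map suc (Sum.map (cong (3 +_)) (Sum.map (cong (3 +_)) (cong (3 +_)))) (residue m)

realisable-≥11 : ∀ m → Realisable (11 + m)
realisable-≥11 m with residue m
... | k , inj₁ refl        = realisable-11+ k
... | k , inj₂ (inj₁ refl) = realisable-12+ k
... | k , inj₂ (inj₂ refl) = realisable-13+ k

-- A shortest walk of length 2 has three distinct vertices.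
diameter2⇒3≤n : {G : Graph n} → HasDiameter G 2 → 3 ≤ n
diameter2⇒3≤n {n} {G} (_ , u , v , (_∷_ {v = w} uw (wv ∷ [])) , shortest) =
  ≤-trans (unique⇒length≤ (u ∷ w ∷ v ∷ []) {Subset.⊤} ((u≢w ∷ u≢v ∷ []) ∷ (w≢v ∷ []) ∷ [] ∷ [])
            (∈⊤ ∷ ∈⊤ ∷ ∈⊤ ∷ []))
          (∣p∣≤n {n} Subset.⊤)
  where
  u≢w : u ≢ w
  u≢w refl = Graph.irrefl G refl uw

  w≢v : w ≢ v
  w≢v refl = Graph.irrefl G refl wv

  u≢v : u ≢ v
  u≢v refl = shortest 0 (s≤s z≤n) []

Admissible : ℕ → Set
Admissible n = (n ≡ 3 ⊎ n ≡ 4 ⊎ n ≡ 5 ⊎ n ≡ 8) ⊎ n ≥ 11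

admissible : ∀ n → Realisable n → Admissible n
admissible n (G , number , diameter) = go n (diameter2⇒3≤n diameter) (obstructionFree G number diameter)
  where
  go : ∀ n {G : Graph n} → 3 ≤ n → ObstructionFree G → Admissible n
  go 1 (s≤s ()) _
  go 2 (s≤s (s≤s ())) _
  go 3  _ _    = inj₁ (inj₁ refl)
  go 4  _ _    = inj₁ (inj₂ (inj₁ refl))
  go 5  _ _    = inj₁ (inj₂ (inj₂ (inj₁ refl)))
  go 6  _ free = contradiction free noSix
  go 7  _ free = contradiction free noSeven
  go 8  _ _    = inj₁ (inj₂ (inj₂ (inj₂ refl)))
  go 9  _ free = contradiction free noNine
  go 10 _ free = contradiction free noTen
  go (suc (suc (suc (suc (suc (suc (suc (suc (suc (suc (suc n))))))))))) _ _ = inj₂ (ℕ.m≤m+n 11 n)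

realisable : ∀ n → Admissible n → Realisable n
realisable _ (inj₁ (inj₁ refl))               = realisable-3
realisable _ (inj₁ (inj₂ (inj₁ refl)))        = realisable-4
realisable _ (inj₁ (inj₂ (inj₂ (inj₁ refl)))) = realisable-5
realisable _ (inj₁ (inj₂ (inj₂ (inj₂ refl)))) = realisable-8
realisable n (inj₂ 11≤n) = subst Realisable (ℕ.m+[n∸m]≡n 11≤n) (realisable-≥11 _)

theorem4p4 : (n : ℕ) → .{{_ : NonZero n}} →
    (Σ[ G ∈ Graph n ] (HasMonophonicPositionNumber G 2 × HasDiameter G 2))
    ⇔ ((n ≡ 3 ⊎ n ≡ 4 ⊎ n ≡ 5 ⊎ n ≡ 8) ⊎ n ≥ 11)
theorem4p4 n = mk⇔ (admissible n) (realisable n)
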